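{- Let $n\ge 0$ and let $\Sigma$ be a finite alphabet. A language $L\subseteq\Sigma^{\circledast}$ is recognized by a (finite) direct product of copies of $\Delta_n$ if and only if $L$ is definable in $\mathrm{FO}^1[(\infty_j)_{j\le n}]$.
   Context: Words. A (countable) word over a set $A$ is a map $w$ from a countable, possibly empty, linear ordering $\mathrm{dom}(w)$ to $A$, taken up to isomorphism; $A^{\circledast}$ is the set of all such words (including the empty word $\varepsilon$). For words $(w_i)_{i\in\alpha}$ indexed by a countable linear ordering $\alpha$, $\prod_{i\in\alpha}w_i$ is their generalized concatenation. $w^{\omega}$ and $w^{\omega^*}$ are the concatenations of copies of $w$ indexed by $(\mathbb N,<)$ and $(-\mathbb N,<)$. For a finite nonempty set $E$, the perfect shuffle $E^{\eta}$ is the (unique up to isomorphism) word of domain $(\mathbb Q,<)$ using only letters of $E$ in which every nonempty non-singleton interval contains every letter of $E$. Algebra. A $\circledast$-monoid $(M,\mathrm{id},\pi)$ is a set $M$ with a map $\pi:M^{\circledast}\to M$ such that $\pi(a)=a$ for $a\in M$, $\pi(\prod_{i\in\alpha}u_i)=\pi(\prod_{i\in\alpha}\pi(u_i))$ for all countable linear orderings $\alpha$ and words $u_i$ over $M$, and $\mathrm{id}=\pi(\varepsilon)$. It induces the $\circledast$-algebra $(M,\mathrm{id},\cdot,\tau,\tau^*,\kappa)$ with $a\cdot b=\pi(ab)$, $a^{\tau}=\pi(a^{\omega})$, $a^{\tau^*}=\pi(a^{\omega^*})$, $E^{\kappa}=\pi(E^{\eta})$ for nonempty finite $E\subseteq M$.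 A finite $\circledast$-monoid is determined by its $\circledast$-algebra, and the two are identified. A morphism $h:M\to M'$ satisfies $h(\pi(w))=\pi'(\bar h(w))$, where $\bar h$ is the letterwise extension of $h$. $\Sigma^{\circledast}$ with generalized concatenation is the free $\circledast$-monoid over $\Sigma$. $L\subseteq\Sigma^{\circledast}$ is recognized by $M$ if there is a morphism $h:\Sigma^{\circledast}\to M$ with $L=h^{ -1}(h(L))$. Direct products are componentwise. $\Delta_n$ is the (finite) $\circledast$-algebra with underlying set $\{\mathrm{id},0,1,\dots,n\}$, identity $\mathrm{id}$, $i\cdot j=\max(i,j)$ and $i^{\tau}=i^{\tau^*}=\min(i+1,n)$ for $i,j\in\{0,\dots,n\}$, $\mathrm{id}^{\tau}=\mathrm{id}^{\tau^*}=\{\mathrm{id}\}^{\kappa}=\mathrm{id}$, and $S^{\kappa}=n$ whenever $S\setminus\{\mathrm{id}\}\neq\emptyset$. Infinitary rank. Let $\mathcal I_0$ be the set of nonempty finite linear orderings. For $n\ge1$, $\mathcal I_n$ is the set of (nonempty) orderings of the form $\sum_{i\in\mathbb Z}\alpha_i$ with each $\alpha_i\in\mathcal I_{n-1}$ or empty, closed under finite sums. The infinitary rank $\mathcal I\text{ - }\mathit{rank}(\alpha)$ is the least $n$ with $\alpha\in\mathcal I_n$, and is infinite if no such $n$ exists. Logic. Formulas of $\mathrm{FO}[(\infty_j)_{j\le n}]$ are built from $x<y$, $a(x)$ ($a\in\Sigma$; "position $x$ carries letter $a$"), boolean connectives, $\exists x$, and the infinitary quantifiers $\exists^{\infty_j}x$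 for $0\le j\le n$; all variables range over positions of the word. Semantics: $w,s\models\exists^{\infty_j}x\,\varphi$ iff there is $X\subseteq\mathrm{dom}(w)$ with $\mathcal I\text{ - }\mathit{rank}(X)=j$ (for the induced ordering) and $w,s[x=i]\models\varphi$ for all $i\in X$; in particular $\exists^{\infty_0}$ is equivalent to $\exists$. $\mathrm{FO}^1[(\infty_j)_{j\le n}]$ is the fragment using only one variable. A language is definable in a logic if it is the set of words satisfying some sentence of the logic. -}

module Defs where

open import Data.Bool.Base using (Bool; T; if_then_else_)
open import Data.Bool.Properties using (T-irrelevant)
open import Data.Empty using (⊥-elim)
open import Data.Fin.Base using (Fin; zero; suc; toℕ; fromℕ; fromℕ<)
import Data.Fin.Base as Fin
import Data.Fin.Properties as Fin
open import Data.Fin.Subset using (Subset; ⁅_⁆; _∪_; _∈_) renaming (⊥ to ∅)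
open import Data.Fin.Subset.Properties using (x∈p∪q⁻; x∈⁅y⁆⇒x≡y; ∉⊥)
open import Data.Integer.Base using (ℤ; +_; -[1+_])
import Data.Integer.Base as ℤ
import Data.Integer.Properties as ℤ
open import Data.List.Base using (any)
open import Data.List.NonEmpty.Base using (List⁺; toList)
import Data.List.Membership.Setoid as Membership
open import Data.Maybe.Base using (Maybe; just; nothing; is-just)
open import Data.Nat.Base using (ℕ; zero; suc; _*_; _⊔_; _⊓_; s≤s)
import Data.Nat.Base as ℕ
import Data.Nat.Properties as ℕ
open import Data.Product.Base using (Σ; Σ-syntax; ∃-syntax; _×_; _,_; proj₁; proj₂)
open import Data.Rational.Base using (ℚ; mkℚ)
import Data.Rational.Base as ℚ
import Data.Rational.Properties as ℚ
open import Data.Sum.Base using (_⊎_; [_,_])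
open import Data.Vec.Functional using ([]; _∷_)
import Data.Vec.Functional.Relation.Binary.Equality.Setoid as Pointwise
open import Function.Base using (_∘_; id; const)
open import Function.Bundles using (_↣_; mk↣; _↔_; _⇔_; Injection)
open import Level using (Level; Lift; 0ℓ)
import Level
open import Relation.Binary.Bundles using (Setoid)
open import Relation.Binary.Core using (Rel)
open import Relation.Binary.Definitions using (Trichotomous; Tri; tri<; tri≈; tri>)
import Relation.Binary.Construct.Flip.EqAndOrd as Flip
open import Relation.Binary.Morphism.Structures using (IsOrderIsomorphism)
import Relation.Binary.Morphism.Construct.Composition as Composition
open import Relation.Binary.PropositionalEquality
  using (_≡_; _≢_; refl; sym; trans; cong; subst; isEquivalence; resp₂; setoid)
open import Relation.Binary.Structures using (IsStrictTotalOrder)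
open import Relation.Nullary using (¬_; yes; no; contradiction)
open import Relation.Unary using (Pred)

private
  variable
    a b c ℓ ℓ₁ ℓ₂ : Level

1ℓ : Level
1ℓ = Level.suc 0ℓ

------------------------------------------------------------------------
-- Linear orderings

record LinearOrder : Set₁ where
  infix 4 _<_
  field
    Carrier            : Set
    _<_                : Rel Carrier 0ℓ
    isStrictTotalOrder : IsStrictTotalOrder _≡_ _<_

  open IsStrictTotalOrder isStrictTotalOrder public
    using (compare; irrefl; asym) renaming (trans to <-trans)

∣_∣ : LinearOrder → Set
∣_∣ = LinearOrder.Carrier

infix 4 _≃_

record _≃_ (α β : LinearOrder) : Set where
  private
    module α = LinearOrder α
    module β = LinearOrder β
  field
    to    : ∣ α ∣ → ∣ β ∣
    isIso : IsOrderIsomorphism _≡_ _≡_ α._<_ β._<_ to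

  open IsOrderIsomorphism isIso public using (mono; cancel; surjective)

  from : ∣ β ∣ → ∣ α ∣
  from y = proj₁ (surjective y)

  to∘from : ∀ y → to (from y) ≡ y
  to∘from y = proj₂ (surjective y) refl

mk≃ : (α β : LinearOrder) (f : ∣ α ∣ → ∣ β ∣) →
      (∀ {x y} → LinearOrder._<_ α x y → LinearOrder._<_ β (f x) (f y)) →
      (∀ y → ∃[ x ] f x ≡ y) → α ≃ β
mk≃ α β f mono surj = record
  { to    = f
  ; isIso = record
    { isOrderMonomorphism = record
      { isOrderHomomorphism = record { cong = cong f ; mono = mono }
      ; injective           = injective
      ; cancel              = cancel
      }
    ; surjective = λ y → proj₁ (surj y) , λ { refl → proj₂ (surj y) }
    }
  }
  where
  module α = LinearOrder α
  module β = LinearOrder β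

  injective : ∀ {x y} → f x ≡ f y → x ≡ y
  injective {x} {y} eq with α.compare x y
  ... | tri< x<y _ _ = ⊥-elim (β.irrefl eq (mono x<y))
  ... | tri≈ _ x≡y _ = x≡y
  ... | tri> _ _ y<x = ⊥-elim (β.irrefl (sym eq) (mono y<x))

  cancel : ∀ {x y} → f x β.< f y → x α.< y
  cancel {x} {y} fx<fy with α.compare x y
  ... | tri< x<y _ _ = x<y
  ... | tri≈ _ refl _ = ⊥-elim (β.irrefl refl fx<fy)
  ... | tri> _ _ y<x = ⊥-elim (β.asym fx<fy (mono y<x))

≃-refl : ∀ {α} → α ≃ α
≃-refl {α} = mk≃ α α id id (λ y → y , refl)

≃-sym : ∀ {α β} → α ≃ β → β ≃ α
≃-sym {α} {β} f = mk≃ β α F.from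
  (λ {x} {y} x<y → F.cancel
    (subst (λ z → z β.< F.to (F.from y)) (sym (F.to∘from x))
      (subst (x β.<_) (sym (F.to∘from y)) x<y)))
  (λ x → F.to x , IsOrderIsomorphism.injective F.isIso (F.to∘from (F.to x)))
  where
  module β = LinearOrder β
  module F = _≃_ f

≃-trans : ∀ {α β γ} → α ≃ β → β ≃ γ → α ≃ γ
≃-trans f g = record
  { to    = _≃_.to g ∘ _≃_.to f
  ; isIso = Composition.isOrderIsomorphism trans (_≃_.isIso f) (_≃_.isIso g)
  }

finₒ : ℕ → LinearOrder
finₒ k = record { Carrier = Fin k ; _<_ = Fin._<_ ; isStrictTotalOrder = Fin.<-isStrictTotalOrder }

ℕₒ : LinearOrder
ℕₒ = record { isStrictTotalOrder = ℕ.<-isStrictTotalOrder }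

-ℕₒ : LinearOrder
-ℕₒ = record { isStrictTotalOrder = Flip.isStrictTotalOrder ℕ.<-isStrictTotalOrder }

ℤₒ : LinearOrder
ℤₒ = record { isStrictTotalOrder = ℤ.<-isStrictTotalOrder }

ℚₒ : LinearOrder
ℚₒ = record { isStrictTotalOrder = ℚ.<-isStrictTotalOrder }

module _ (ι : LinearOrder) (α : ∣ ι ∣ → LinearOrder) where
  private
    module ι = LinearOrder ι
    module α i = LinearOrder (α i)

  data _<ˡᵉˣ_ : Rel (Σ[ i ∈ ∣ ι ∣ ] ∣ α i ∣) 0ℓ where
    inter : ∀ {i j x y} → i ι.< j → (i , x) <ˡᵉˣ (j , y)
    intra : ∀ {i x y} → LinearOrder._<_ (α i) x y → (i , x) <ˡᵉˣ (i , y)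

  private
    <ˡᵉˣ-trans : ∀ {p q r} → p <ˡᵉˣ q → q <ˡᵉˣ r → p <ˡᵉˣ r
    <ˡᵉˣ-trans (inter i<j) (inter j<k) = inter (ι.<-trans i<j j<k)
    <ˡᵉˣ-trans (inter i<j) (intra _)   = inter i<j
    <ˡᵉˣ-trans (intra _)   (inter i<j) = inter i<j
    <ˡᵉˣ-trans (intra {i} x<y) (intra y<z) = intra (α.<-trans i x<y y<z)

    <ˡᵉˣ-irrefl : ∀ {p} → ¬ p <ˡᵉˣ p
    <ˡᵉˣ-irrefl (inter i<i)     = ι.irrefl refl i<i
    <ˡᵉˣ-irrefl (intra {i} x<x) = α.irrefl i refl x<x

    less : ∀ {p q} → p <ˡᵉˣ q → Tri (p <ˡᵉˣ q) (p ≡ q) (q <ˡᵉˣ p)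
    less {p} {q} p<q = tri< p<q (λ { refl → <ˡᵉˣ-irrefl p<q })
                                (λ q<p → <ˡᵉˣ-irrefl (<ˡᵉˣ-trans p<q q<p))

    greater : ∀ {p q} → q <ˡᵉˣ p → Tri (p <ˡᵉˣ q) (p ≡ q) (q <ˡᵉˣ p)
    greater {p} {q} q<p = tri> (λ p<q → <ˡᵉˣ-irrefl (<ˡᵉˣ-trans p<q q<p))
                               (λ { refl → <ˡᵉˣ-irrefl q<p }) q<p

    <ˡᵉˣ-compare : Trichotomous _≡_ _<ˡᵉˣ_
    <ˡᵉˣ-compare (i , x) (j , y) with ι.compare i j
    ... | tri< i<j _ _ = less (inter i<j)
    ... | tri> _ _ j<i = greater (inter j<i)
    ... | tri≈ _ refl _ with α.compare i x y
    ...   | tri< x<y _ _  = less (intra x<y)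
    ...   | tri≈ _ refl _ = tri≈ <ˡᵉˣ-irrefl refl <ˡᵉˣ-irrefl
    ...   | tri> _ _ y<x  = greater (intra y<x)

  -- The ordered sum Σ_{i∈ι} αᵢ.
  sumₒ : LinearOrder
  sumₒ = record
    { Carrier            = Σ[ i ∈ ∣ ι ∣ ] ∣ α i ∣
    ; _<_                = _<ˡᵉˣ_
    ; isStrictTotalOrder = record
      { isStrictPartialOrder = record
        { isEquivalence = isEquivalence
        ; irrefl        = λ { refl → <ˡᵉˣ-irrefl }
        ; trans         = <ˡᵉˣ-trans
        ; <-resp-≈      = resp₂ _<ˡᵉˣ_
        }
      ; compare = <ˡᵉˣ-compare
      }
    }

sumₒ-cong : ∀ {ι κ} {α : ∣ ι ∣ → LinearOrder} {β : ∣ κ ∣ → LinearOrder}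
            (f : ι ≃ κ) → (∀ i → α i ≃ β (_≃_.to f i)) → sumₒ ι α ≃ sumₒ κ β
sumₒ-cong {ι} {κ} {α} {β} f g = mk≃ (sumₒ ι α) (sumₒ κ β)
  (λ (i , x) → F.to i , _≃_.to (g i) x)
  (λ { (inter i<j) → inter (F.mono i<j) ; (intra {i} x<y) → intra (_≃_.mono (g i) x<y) })
  surj
  where
  module F = _≃_ f
  surj : ∀ q → ∃[ p ] (F.to (proj₁ p) , _≃_.to (g (proj₁ p)) (proj₂ p)) ≡ q
  surj (j , y) with F.from j | F.to∘from j
  ... | i | refl = (i , _≃_.from (g i) y) , cong (F.to i ,_) (_≃_.to∘from (g i) y)

-- Subsets are characteristic functions, so that membership is proof-irrelevant
-- and the restricted carrier really is a subset; under excluded middle these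
-- are all the subsets.
restrict : (α : LinearOrder) → (∣ α ∣ → Bool) → LinearOrder
restrict α X = record
  { Carrier            = Σ[ x ∈ ∣ α ∣ ] T (X x)
  ; _<_                = λ p q → proj₁ p α.< proj₁ q
  ; isStrictTotalOrder = record
    { isStrictPartialOrder = record
      { isEquivalence = isEquivalence
      ; irrefl        = λ { refl → α.irrefl refl }
      ; trans         = α.<-trans
      ; <-resp-≈      = resp₂ (λ p q → proj₁ p α.< proj₁ q)
      }
    ; compare = compare
    }
  }
  where
  module α = LinearOrder α
  compare : Trichotomous _≡_ (λ (p q : Σ[ x ∈ ∣ α ∣ ] T (X x)) → proj₁ p α.< proj₁ q)
  compare (x , x∈) (y , y∈) with α.compare x y
  ... | tri< x<y x≢y x≯y = tri< x<y (x≢y ∘ cong proj₁) x≯y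
  ... | tri≈ x≮y refl x≯y = tri≈ x≮y (cong (x ,_) (T-irrelevant x∈ y∈)) x≯y
  ... | tri> x≮y x≢y x>y = tri> x≮y (x≢y ∘ cong proj₁) x>y

------------------------------------------------------------------------
-- Infinitary rank

data 𝓘 : ℕ → LinearOrder → Set₁ where
  finite  : ∀ {α} k → ∣ α ∣ ↔ Fin (suc k) → 𝓘 zero α
  ℤ-sum   : ∀ {n β} (α : ℤ → LinearOrder) → (∀ i → 𝓘 n (α i) ⊎ ¬ ∣ α i ∣) →
            β ≃ sumₒ ℤₒ α → ∣ β ∣ → 𝓘 (suc n) β
  fin-sum : ∀ {n β} k (α : Fin (suc k) → LinearOrder) → (∀ i → 𝓘 (suc n) (α i)) →
            β ≃ sumₒ (finₒ (suc k)) α → 𝓘 (suc n) β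

HasRank : LinearOrder → ℕ → Set₁
HasRank α n = 𝓘 n α × (∀ m → m ℕ.< n → ¬ 𝓘 m α)

------------------------------------------------------------------------
-- Countability

Countable : Set → Set
Countable A = A ↣ ℕ

private
  code : ∀ {A} → Countable A → A → ℕ
  code = Injection.to

  code-injective : ∀ {A} (f : Countable A) {x y} → code f x ≡ code f y → x ≡ y
  code-injective = Injection.injective

  pair : ℕ → ℕ → ℕ
  pair zero    n = suc (2 * n)
  pair (suc m) n = 2 * pair m n

  pair-injective : ∀ m n m′ n′ → pair m n ≡ pair m′ n′ → m ≡ m′ × n ≡ n′
  pair-injective zero    n zero     n′ eq = refl , ℕ.*-cancelˡ-≡ n n′ 2 (ℕ.suc-injective eq)
  pair-injective zero    n (suc m′) n′ eq = ⊥-elim (ℕ.even≢odd (pair m′ n′) n (sym eq))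
  pair-injective (suc m) n zero     n′ eq = ⊥-elim (ℕ.even≢odd (pair m n) n′ eq)
  pair-injective (suc m) n (suc m′) n′ eq
    with pair-injective m n m′ n′ (ℕ.*-cancelˡ-≡ (pair m n) (pair m′ n′) 2 eq)
  ... | refl , n≡n′ = refl , n≡n′

Fin-countable : ∀ {k} → Countable (Fin k)
Fin-countable = mk↣ {to = toℕ} Fin.toℕ-injective

ℕ-countable : Countable ℕ
ℕ-countable = mk↣ {to = id} id

ℤ-countable : Countable ℤ
ℤ-countable = mk↣ {to = encode} (λ {x} {y} → injective x y)
  where
  encode : ℤ → ℕ
  encode (+ n)    = pair 0 n
  encode -[1+ n ] = pair 1 n

  injective : ∀ x y → encode x ≡ encode y → x ≡ y
  injective (+ m)    (+ n)    eq = cong +_ (proj₂ (pair-injective 0 m 0 n eq))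
  injective (+ m)    -[1+ n ] eq with () ← proj₁ (pair-injective 0 m 1 n eq)
  injective -[1+ m ] (+ n)    eq with () ← proj₁ (pair-injective 1 m 0 n eq)
  injective -[1+ m ] -[1+ n ] eq = cong -[1+_] (proj₂ (pair-injective 1 m 1 n eq))

ℚ-countable : Countable ℚ
ℚ-countable = mk↣ {to = encode} (λ {p} {q} → injective p q)
  where
  encode : ℚ → ℕ
  encode (mkℚ n d _) = pair (code ℤ-countable n) d

  injective : ∀ p q → encode p ≡ encode q → p ≡ q
  injective (mkℚ n d _) (mkℚ n′ d′ _) eq
    with pair-injective (code ℤ-countable n) d (code ℤ-countable n′) d′ eq
  ... | n≡ , d≡ = ℚ.mkℚ-cong (code-injective ℤ-countable n≡) d≡

Σ-countable : ∀ {I : Set} {A : I → Set} → Countable I → (∀ i → Countable (A i)) → Countable (Σ I A)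
Σ-countable {I} {A} f g = mk↣ {to = encode} (λ {p} {q} → injective p q)
  where
  encode : Σ I A → ℕ
  encode (i , x) = pair (code f i) (code (g i) x)

  injective : ∀ p q → encode p ≡ encode q → p ≡ q
  injective (i , x) (j , y) eq
    with pair-injective (code f i) (code (g i) x) (code f j) (code (g j) y) eq
  ... | fi≡fj , gx≡gy with code-injective f fi≡fj
  ...   | refl = cong (i ,_) (code-injective (g i) gx≡gy)

------------------------------------------------------------------------
-- Words

record Word (A : Set a) : Set (1ℓ Level.⊔ a) where
  field
    dom       : LinearOrder
    countable : Countable ∣ dom ∣
    letter    : ∣ dom ∣ → A

open Word public

map : ∀ {A : Set a} {B : Set b} → (A → B) → Word A → Word B
map f w = record { dom = dom w ; countable = countable w ; letter = f ∘ letter w }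

-- A word whose letters are words is a family of words indexed by a countable
-- linear ordering; its generalized concatenation is taken over that ordering.
concat : ∀ {A : Set a} → Word (Word A) → Word A
concat u = record
  { dom       = sumₒ (dom u) (dom ∘ letter u)
  ; countable = Σ-countable (countable u) (countable ∘ letter u)
  ; letter    = λ (i , x) → letter (letter u i) x
  }

module _ {A : Set a} where

  finiteWord : ∀ {k} → (Fin k → A) → Word A
  finiteWord {k} s = record { dom = finₒ k ; countable = Fin-countable ; letter = s }

  ε : Word A
  ε = finiteWord []

  singleton : A → Word A
  singleton x = finiteWord (x ∷ [])

  two : A → A → Word A
  two x y = finiteWord (x ∷ y ∷ [])

  infix 8 _^ω _^ω*

  _^ω : A → Word A
  x ^ω = record { dom = ℕₒ ; countable = ℕ-countable ; letter = const x }

  _^ω* : A → Word A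
  x ^ω* = record { dom = -ℕₒ ; countable = ℕ-countable ; letter = const x }

  ℚ-word : (ℚ → A) → Word A
  ℚ-word s = record { dom = ℚₒ ; countable = ℚ-countable ; letter = s }

-- Equality of words: isomorphism of the domains respecting letters.
module _ (S : Setoid c ℓ) where
  open Setoid S using (Carrier; _≈_)

  infix 4 _≅_

  record _≅_ (v w : Word Carrier) : Set ℓ where
    field
      iso     : dom v ≃ dom w
      letters : ∀ x → letter v x ≈ letter w (_≃_.to iso x)

wordSetoid : Setoid c ℓ → Setoid (1ℓ Level.⊔ c) ℓ
wordSetoid S = record
  { Carrier       = Word Carrier
  ; _≈_           = _≅_ S
  ; isEquivalence = record
    { refl  = record { iso = ≃-refl ; letters = λ _ → S.refl }
    ; sym   = λ {v} {w} p → let open _≅_ p in record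
      { iso     = ≃-sym iso
      ; letters = λ y → S.sym (S.trans (letters (_≃_.from iso y))
                                       (S.reflexive (cong (letter w) (_≃_.to∘from iso y))))
      }
    ; trans = λ p q → record
      { iso     = ≃-trans (_≅_.iso p) (_≅_.iso q)
      ; letters = λ x → S.trans (_≅_.letters p x) (_≅_.letters q _)
      }
    }
  }
  where
  module S = Setoid S
  open S using (Carrier)

------------------------------------------------------------------------
-- ⊛-monoids

record ⊛Monoid (S : Setoid c ℓ) : Set (1ℓ Level.⊔ c Level.⊔ ℓ) where
  open Setoid S
  field
    π           : Word Carrier → Carrier
    π-cong      : ∀ {v w} → _≅_ S v w → π v ≈ π w
    π-singleton : ∀ x → π (singleton x) ≈ x
    π-concat    : ∀ (u : Word (Word Carrier)) → π (concat u) ≈ π (map π u)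

  identity : Carrier
  identity = π ε

record Morphism {S : Setoid c ℓ} {S′ : Setoid ℓ₁ ℓ₂} (M : ⊛Monoid S) (M′ : ⊛Monoid S′)
       : Set (1ℓ Level.⊔ c Level.⊔ ℓ Level.⊔ ℓ₁ Level.⊔ ℓ₂) where
  private
    module S  = Setoid S
    module S′ = Setoid S′
  field
    ⟦_⟧    : S.Carrier → S′.Carrier
    ⟦⟧-cong : ∀ {x y} → x S.≈ y → ⟦ x ⟧ S′.≈ ⟦ y ⟧
    homo   : ∀ w → ⟦ ⊛Monoid.π M w ⟧ S′.≈ ⊛Monoid.π M′ (map ⟦_⟧ w)

Free : (A : Set a) → ⊛Monoid (wordSetoid (setoid A))
Free A = record
  { π           = concat
  ; π-cong      = λ p → record
    { iso     = sumₒ-cong (_≅_.iso p) (λ i → _≅_.iso (_≅_.letters p i))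
    ; letters = λ (i , x) → _≅_.letters (_≅_.letters p i) x
    }
  ; π-singleton = λ w → record
    { iso     = mk≃ (dom (concat (singleton w))) (dom w) (λ { (zero , x) → x })
                    (λ { {zero , _} {zero , _} (inter ()) ; {zero , _} {zero , _} (intra x<y) → x<y })
                    (λ x → (zero , x) , refl)
    ; letters = λ { (zero , x) → refl }
    }
  ; π-concat    = λ u → record
    { iso     = mk≃ (dom (concat (concat u))) (dom (concat (map concat u)))
                    (λ ((i , j) , x) → i , (j , x))
                    (λ { (inter (inter i<i′)) → inter i<i′
                       ; (inter (intra j<j′)) → intra (inter j<j′)
                       ; (intra x<x′)         → intra (intra x<x′) })
                    (λ (i , (j , x)) → ((i , j) , x) , refl)
    ; letters = λ _ → refl
    }
  }

-- The direct product of k copies of a ⊛-monoid.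
power : {S : Setoid c ℓ} → ⊛Monoid S → (k : ℕ) → ⊛Monoid (Pointwise.≋-setoid S k)
power {S = S} M k = record
  { π           = λ w i → π (map (λ x → x i) w)
  ; π-cong      = λ p i → π-cong (record { iso = _≅_.iso p ; letters = λ x → _≅_.letters p x i })
  ; π-singleton = λ x i → S.trans (π-cong (record { iso     = ≃-refl
                                                  ; letters = λ { zero → S.refl } }))
                                  (π-singleton (x i))
  ; π-concat    = λ u i → π-concat (map (map (λ x → x i)) u)
  }
  where
  open ⊛Monoid M
  module S = Setoid S

------------------------------------------------------------------------
-- ⊛-algebras

-- A nonempty finite set E is given by a list enumerating it.
record ⊛Algebra (S : Setoid c ℓ) : Set c where
  open Setoid S using (Carrier)
  field
    𝟙   : Carrier
    _·_ : Carrier → Carrier → Carrier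
    _^τ  : Carrier → Carrier
    _^τ* : Carrier → Carrier
    _^κ  : List⁺ Carrier → Carrier

module _ (S : Setoid c ℓ) where
  open Setoid S using (Carrier; _≈_)
  open Membership S renaming (_∈_ to _∈ˡ_)

  record IsPerfectShuffle (E : List⁺ Carrier) (s : ℚ → Carrier) : Set (c Level.⊔ ℓ) where
    field
      letters-in-E : ∀ q → s q ∈ˡ toList E
      dense        : ∀ (I : ℚ → Bool) →
                     (∀ {p q r} → p ℚ.< q → q ℚ.< r → T (I p) → T (I r) → T (I q)) →
                     (∃[ p ] ∃[ q ] p ≢ q × T (I p) × T (I q)) →
                     ∀ e → e ∈ˡ toList E → ∃[ q ] T (I q) × s q ≈ e

module _ {S : Setoid c ℓ} where
  open Setoid S using (_≈_)

  record Induces (M : ⊛Monoid S) (𝒜 : ⊛Algebra S) : Set (c Level.⊔ ℓ) where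
    open ⊛Monoid M
    open ⊛Algebra 𝒜
    field
      𝟙-induced  : 𝟙 ≈ identity
      ·-induced  : ∀ x y → x · y ≈ π (two x y)
      τ-induced  : ∀ x → x ^τ ≈ π (x ^ω)
      τ*-induced : ∀ x → x ^τ* ≈ π (x ^ω*)
      -- The perfect shuffle of E is unique only up to isomorphism.
      κ-induced  : ∀ E s → IsPerfectShuffle S E s → E ^κ ≈ π (ℚ-word s)

-- The underlying set {id, 0, …, n} of Δₙ, with nothing for id.
ΔSetoid : ℕ → Setoid 0ℓ 0ℓ
ΔSetoid n = setoid (Maybe (Fin (suc n)))

Δ : ∀ n → ⊛Algebra (ΔSetoid n)
Δ n = record
  { 𝟙    = nothing
  ; _·_  = _·_
  ; _^τ  = bump
  ; _^τ* = bump
  ; _^κ  = λ E → if any is-just (toList E) then just (fromℕ n) else nothing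
  }
  where
  _·_ : Maybe (Fin (suc n)) → Maybe (Fin (suc n)) → Maybe (Fin (suc n))
  nothing · y       = y
  x       · nothing = x
  just i  · just j  = just (fromℕ< {toℕ i ⊔ toℕ j} (ℕ.⊔-pres-<m (Fin.toℕ<n i) (Fin.toℕ<n j)))

  bump : Maybe (Fin (suc n)) → Maybe (Fin (suc n))
  bump nothing  = nothing
  bump (just i) = just (fromℕ< {suc (toℕ i) ⊓ n} (s≤s (ℕ.m⊓n≤n (suc (toℕ i)) n)))

------------------------------------------------------------------------
-- Languages and recognition

record Language (A : Set) : Set (Level.suc 1ℓ) where
  infix 4 _∈ᴸ
  field
    _∈ᴸ  : Pred (Word A) 1ℓ
    resp : ∀ {v w} → _≅_ (setoid A) v w → v ∈ᴸ → w ∈ᴸ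

RecognizedBy : ∀ {A : Set} {S : Setoid c ℓ} → ⊛Monoid S → Language A → Set (1ℓ Level.⊔ c Level.⊔ ℓ)
RecognizedBy {A = A} {S} M L =
  Σ[ h ∈ Morphism (Free A) M ]
    let open Morphism h in
    ∀ w → (w ∈ᴸ) ⇔ (∃[ v ] v ∈ᴸ × ⟦ w ⟧ ≈ ⟦ v ⟧)
  where
  open Setoid S using (_≈_)
  open Language L

-- A finite ⊛-monoid is identified with its ⊛-algebra: Δₙ as a ⊛-monoid is the
-- (unique) one inducing Δ n.
RecognizedByΔ-product : ∀ {A : Set} → ℕ → Language A → Set₁
RecognizedByΔ-product n L =
  Σ[ D ∈ ⊛Monoid (ΔSetoid n) ] Induces D (Δ n) × (∃[ k ] RecognizedBy (power D k) L)

------------------------------------------------------------------------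
-- Logic

-- Formulas of FO[(∞ⱼ)_{j≤n}] over the alphabet A, written with v variable names
-- and with free variables in Γ. A quantifier may rebind a variable already in
-- scope, so v bounds the number of distinct variables, not the nesting depth.
data Formula (A : Set) (n v : ℕ) (Γ : Subset v) : Set where
  less  : ∀ x y → x ∈ Γ → y ∈ Γ → Formula A n v Γ
  atom  : A → ∀ x → x ∈ Γ → Formula A n v Γ
  not   : Formula A n v Γ → Formula A n v Γ
  _and_ : Formula A n v Γ → Formula A n v Γ → Formula A n v Γ
  _or_  : Formula A n v Γ → Formula A n v Γ → Formula A n v Γ
  ex    : ∀ x → Formula A n v (⁅ x ⁆ ∪ Γ) → Formula A n v Γ
  ex∞   : Fin (suc n) → ∀ x → Formula A n v (⁅ x ⁆ ∪ Γ) → Formula A n v Γ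

Sentence : Set → ℕ → ℕ → Set
Sentence A n v = Formula A n v ∅

module _ {A : Set} (w : Word A) where

  Assignment : ∀ {v} → Subset v → Set
  Assignment Γ = ∀ x → x ∈ Γ → ∣ dom w ∣

  _[_≔_] : ∀ {v} {Γ : Subset v} → Assignment Γ → ∀ x → ∣ dom w ∣ → Assignment (⁅ x ⁆ ∪ Γ)
  _[_≔_] {Γ = Γ} s x i y y∈ with y Fin.≟ x
  ... | yes _   = i
  ... | no  y≢x = [ (λ y∈⁅x⁆ → contradiction (x∈⁅y⁆⇒x≡y x y∈⁅x⁆) y≢x) , s y ] (x∈p∪q⁻ ⁅ x ⁆ Γ y∈)

  infix 4 _⊨_

  _⊨_ : ∀ {n v Γ} → Assignment Γ → Formula A n v Γ → Set₁
  s ⊨ less x y x∈ y∈ = Lift 1ℓ (LinearOrder._<_ (dom w) (s x x∈) (s y y∈))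
  s ⊨ atom a x x∈    = Lift 1ℓ (letter w (s x x∈) ≡ a)
  s ⊨ not φ          = ¬ (s ⊨ φ)
  s ⊨ φ and ψ        = (s ⊨ φ) × (s ⊨ ψ)
  s ⊨ φ or ψ         = (s ⊨ φ) ⊎ (s ⊨ ψ)
  s ⊨ ex x φ         = ∃[ i ] s [ x ≔ i ] ⊨ φ
  s ⊨ ex∞ j x φ      = Σ[ X ∈ (∣ dom w ∣ → Bool) ]
                         HasRank (restrict (dom w) X) (toℕ j) ×
                         (∀ i → T (X i) → s [ x ≔ i ] ⊨ φ)

  Satisfies : ∀ {n v} → Sentence A n v → Set₁
  Satisfies φ = (λ _ x∈∅ → ⊥-elim (∉⊥ x∈∅)) ⊨ φ

-- Definability in the fragment of FO[(∞ⱼ)_{j≤n}] with v variables.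
Definable : ∀ {A : Set} → ℕ → ℕ → Language A → Set₁
Definable {A} n v L = Σ[ φ ∈ Sentence A n v ] ∀ w → (w ∈ᴸ) ⇔ Satisfies w φ
  where open Language L

{-# OPTIONS --safe #-}

-- Call a set of positions of a word over Δₙ deep of level v if it contains a letter ≥ v, or
-- contains an ω- or ω*-sequence of consecutive sets that are deep of level v − 1.  Both the
-- value of a word and the infinitary rank of an ordering measure this depth.  Depth is
-- additive (a deep union has a deep part) and passes between a concatenation and the word of
-- values of its factors, so "the largest level of depth" is a ⊛-monoid, and it induces Δₙ.
-- Conversely, a set that is not deep of level v + 1 is obtained by finitely many binary sums
-- and ω- or ω*-sums from single points and sets that are not deep of level v.  For the value
-- in an arbitrary ⊛-monoid inducing Δₙ this shows that the operations · , τ and τ* alone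
-- determine the monoid; for the classes 𝓘 it shows that a set has a subset of rank j if and
-- only if it is deep of level j when all its points are given level 0.
--
-- A word over Σ mapped to Δₙ letter by letter then has value ≥ v if and only if, for some
-- u ≤ v, the positions whose letter has value ≥ v − u contain a set of rank u, which is a
-- one-variable sentence.  Conversely, the truth of a one-variable sentence in w only depends
-- on the values of the words obtained from w by mapping each letter to 0 or id.

module Submission where

open import Defs
open import Axiom.ExcludedMiddle using (ExcludedMiddle)
open import Data.Bool.Base using (Bool; true; false; T; if_then_else_)
open import Data.Bool.ListAction using (any)
open import Data.Bool.Properties using (T-irrelevant)
open import Data.Empty using (⊥; ⊥-elim)
open import Data.Fin.Base using (Fin; zero; suc; toℕ; fromℕ; fromℕ<)
import Data.Fin.Base as Fin
import Data.Fin.Properties as Fin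
open import Data.Fin.Subset using (⁅_⁆; _∪_) renaming (⊥ to ∅)
open import Data.Fin.Subset.Properties using (p⊆p∪q; x∈⁅x⁆; ∉⊥)
open import Data.Integer.Base using (ℤ; +_; -[1+_])
import Data.Integer.Base as ℤ
open import Data.List.Base using (List; []; _∷_; _++_; allFin; upTo) renaming (map to mapₗ)
open import Data.List.Membership.Propositional using (find) renaming (_∈_ to _∈ₗ_)
open import Data.List.Membership.Propositional.Properties
  using (∈-allFin; ∈-upTo⁺; ∈-map⁺; ∈-++⁺ˡ; ∈-++⁺ʳ)
open import Data.List.NonEmpty.Base using (toList)
open import Data.List.Relation.Unary.Any using (Any; here; there)
import Data.List.Relation.Unary.Any as Any
open import Data.List.Relation.Unary.Any.Properties using (any⁺; any⁻)
open import Data.Maybe.Base using (Maybe; just; nothing; is-just)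
open import Data.Nat.Base using (ℕ; zero; suc; s≤s; z≤n; _≤_; _≤′_; ≤′-refl; ≤′-step)
import Data.Nat.Base as ℕ
import Data.Nat.Properties as ℕ
open import Data.Product.Base using (Σ-syntax; ∃; ∃-syntax; _×_; _,_; proj₁; proj₂)
open import Data.Rational.Base using (ℚ)
import Data.Rational.Base as ℚ
import Data.Rational.Properties as ℚ
open import Data.Sum.Base using (_⊎_; inj₁; inj₂; [_,_]′; swap)
open import Data.Unit.Base using (tt)
import Data.Vec.Base as Vec
open import Function.Base using (_∘_; id; const; case_of_)
open import Function.Bundles using (Injection; Inverse; Equivalence; mk↣; _↔_; mk↔ₛ′; _⇔_; mk⇔)
open import Function.Construct.Composition using (_↔-∘_)
open import Function.Construct.Symmetry using (↔-sym; ⇔-sym)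
open import Level using (Lift; lift; lower)
open import Relation.Binary.Bundles using (Setoid)
open import Relation.Binary.Definitions using (tri<; tri≈; tri>)
import Relation.Binary.Construct.Flip.EqAndOrd as Flip
open import Relation.Binary.PropositionalEquality
  using (_≡_; refl; sym; trans; cong; subst; subst₂; module ≡-Reasoning)
open import Relation.Binary.Structures using (IsStrictTotalOrder)
open import Relation.Nullary using (¬_; Dec; yes; no; contradiction)
open import Relation.Nullary.Decidable using (⌊_⌋; toWitness; fromWitness; map′; decidable-stable)

-- Directed orderings, increasing sequences of subsets, and depth

data Dir : Set where
  up down : Dir

orient : Dir → {A : Set} → (A → A → Set) → A → A → Set
orient up   R x y = R x y
orient down R x y = R y x

-- Reversing the ordering for `down` lets one argument treat ω-sequences and ω*-sequences alike.
directed : Dir → LinearOrder → LinearOrder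
directed d α = record { Carrier = ∣ α ∣ ; _<_ = orient d α._<_ ; isStrictTotalOrder = isSTO d }
  where
  module α = LinearOrder α
  isSTO : ∀ d → IsStrictTotalOrder _≡_ (orient d α._<_)
  isSTO up   = α.isStrictTotalOrder
  isSTO down = Flip.isStrictTotalOrder α.isStrictTotalOrder

ω : Dir → LinearOrder
ω d = directed d ℕₒ

Sub : LinearOrder → Set
Sub α = ∣ α ∣ → Bool

_∈_ : {A : Set} → A → (A → Bool) → Set
x ∈ P = T (P x)

_⊆_ : {A : Set} → (A → Bool) → (A → Bool) → Set
P ⊆ Q = ∀ {x} → x ∈ P → x ∈ Q

infix 4 _∈_ _⊆_

Before : (α : LinearOrder) → Sub α → Sub α → Set
Before α P Q = ∀ {x y} → x ∈ P → y ∈ Q → LinearOrder._<_ α x y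

Increasing : (α : LinearOrder) → (ℕ → Sub α) → Set
Increasing α Q = ∀ {j k} → j ℕ.< k → Before α (Q j) (Q k)

StrictlyMono : (ℕ → ℕ) → Set
StrictlyMono φ = ∀ {j k} → j ℕ.< k → φ j ℕ.< φ k

strictlyMono : ∀ φ → (∀ k → φ k ℕ.< φ (suc k)) → StrictlyMono φ
strictlyMono φ step j<k = go (ℕ.≤⇒≤′ j<k)
  where
  go : ∀ {j k} → suc j ≤′ k → φ j ℕ.< φ k
  go ≤′-refl       = step _
  go (≤′-step j≤k) = ℕ.<-trans (go j≤k) (step _)

StrictlyMono⇒≤ : ∀ {φ} → StrictlyMono φ → ∀ {j k} → j ℕ.< k → φ (suc j) ≤ φ k
StrictlyMono⇒≤ φ-mono j<k = [ (λ lt → ℕ.<⇒≤ (φ-mono lt)) , (λ { refl → ℕ.≤-refl }) ]′ (ℕ.m≤n⇒m<n∨m≡n j<k)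

-- lev x v stands for "the letter at x has value at least v".
data Deep (α : LinearOrder) (lev : ∣ α ∣ → ℕ → Set) : ℕ → Sub α → Set where
  point : ∀ {v P} x → x ∈ P → lev x v → Deep α lev v P
  limit : ∀ {v P} d (Q : ℕ → Sub α) → (∀ k → Q k ⊆ P) → Increasing (directed d α) Q →
          (∀ k → Deep α lev v (Q k)) → Deep α lev (suc v) P

module _ {α : LinearOrder} {lev : ∣ α ∣ → ℕ → Set} where

  Deep-nonempty : ∀ {v P} → Deep α lev v P → ∃[ x ] x ∈ P
  Deep-nonempty (point x x∈ _)      = x , x∈
  Deep-nonempty (limit _ Q Q⊆ _ dQ) = let x , x∈ = Deep-nonempty (dQ 0) in x , Q⊆ 0 x∈

  Deep-⊆ : ∀ {v P Q} → P ⊆ Q → Deep α lev v P → Deep α lev v Q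
  Deep-⊆ P⊆Q (point x x∈ l)        = point x (P⊆Q x∈) l
  Deep-⊆ P⊆Q (limit d R R⊆ inc dR) = limit d R (λ k → P⊆Q ∘ R⊆ k) inc dR

  Deep-pred : (∀ {x v} → lev x (suc v) → lev x v) → ∀ {v P} → Deep α lev (suc v) P → Deep α lev v P
  Deep-pred closed (point x x∈ l)       = point x x∈ (closed l)
  Deep-pred closed (limit _ _ Q⊆ _ dQ) = Deep-⊆ (Q⊆ 0) (dQ 0)

-- Partitions along an ordering and elementary closure of the classes 𝓘

record Partition (α β : LinearOrder) (R : Sub α) (Q : ∣ β ∣ → Sub α) : Set where
  field
    parts   : ∀ i → Q i ⊆ R
    cover   : ∀ {x} → x ∈ R → ∃[ i ] x ∈ Q i
    -- This includes disjointness: distinct indices are comparable, and a common point of two parts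
    -- would precede itself.
    ordered : ∀ {i j} → LinearOrder._<_ β i j → Before α (Q i) (Q j)

open Partition

-- For `down` the index ordering is reversed together with `α`, so the parts again appear in the
-- order of `α`.
increasing⇒ordered : ∀ {α Q} d → Increasing (directed d α) Q →
                     ∀ {i j} → LinearOrder._<_ (ω d) i j → Before α (Q i) (Q j)
increasing⇒ordered up   inc i<j         = inc i<j
increasing⇒ordered down inc j<i x∈ y∈ = inc j<i y∈ x∈

sum-≃-restrict : ∀ {α β R Q} → Partition α β R Q → sumₒ β (λ i → restrict α (Q i)) ≃ restrict α R
sum-≃-restrict {α} {β} {R} {Q} p = mk≃ (sumₒ β (λ i → restrict α (Q i))) (restrict α R)
  (λ (i , x , x∈) → x , p .parts i x∈)
  (λ { (inter {x = _ , x∈} {y = _ , y∈} i<j) → p .ordered i<j x∈ y∈ ; (intra x<y) → x<y })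
  (λ (x , x∈) → let i , x∈Q = p .cover x∈ in (i , x , x∈Q) , cong (x ,_) (T-irrelevant _ _))

restrict-≃ : ∀ {α β R Q} → Partition α β R Q → restrict α R ≃ sumₒ β (λ i → restrict α (Q i))
restrict-≃ = ≃-sym ∘ sum-≃-restrict

restrict-cong : ∀ {α P Q} → P ⊆ Q → Q ⊆ P → restrict α P ≃ restrict α Q
restrict-cong {α} {P} {Q} P⊆Q Q⊆P = mk≃ (restrict α P) (restrict α Q) (λ (x , x∈) → x , P⊆Q x∈) id
  (λ (x , x∈) → (x , Q⊆P x∈) , cong (x ,_) (T-irrelevant _ _))

≃⇒↔ : ∀ {α β} → α ≃ β → ∣ α ∣ ↔ ∣ β ∣
≃⇒↔ e = mk↔ₛ′ (_≃_.to e) (_≃_.to (≃-sym e)) (_≃_.to∘from e) (_≃_.to∘from (≃-sym e))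

𝓘-resp-≃ : ∀ {n α β} → α ≃ β → 𝓘 n α → 𝓘 n β
𝓘-resp-≃ e (finite k f)           = finite k (f ↔-∘ ↔-sym (≃⇒↔ e))
𝓘-resp-≃ e (ℤ-sum γ rank f x)     = ℤ-sum γ rank (≃-trans (≃-sym e) f) (_≃_.to e x)
𝓘-resp-≃ e (fin-sum k γ rank f)   = fin-sum k γ rank (≃-trans (≃-sym e) f)

𝓘⇒nonempty : ∀ {n α} → 𝓘 n α → ∣ α ∣
𝓘⇒nonempty (finite k f)         = Inverse.from f zero
𝓘⇒nonempty (ℤ-sum _ _ _ x)      = x
𝓘⇒nonempty (fin-sum k γ rank f) = _≃_.from f (zero , 𝓘⇒nonempty (rank zero))

finite-sum : ∀ {α R} {Q : Fin 2 → Sub α} → Partition α (finₒ 2) R Q →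
             (∀ i → 𝓘 0 (restrict α (Q i))) → 𝓘 0 (restrict α R)
finite-sum {α} {R} {Q} p rank with rank zero | rank (suc zero)
... | finite k f | finite l g =
  finite (k ℕ.+ suc l) (↔-sym Fin.+↔⊎ ↔-∘ (sum↔⊎ ↔-∘ ≃⇒↔ (restrict-≃ p)))
  where
  module f = Inverse f
  module g = Inverse g
  to : Σ[ i ∈ Fin 2 ] ∣ restrict α (Q i) ∣ → Fin (suc k) ⊎ Fin (suc l)
  to (zero , x)     = inj₁ (f.to x)
  to (suc zero , y) = inj₂ (g.to y)
  sum↔⊎ : (Σ[ i ∈ Fin 2 ] ∣ restrict α (Q i) ∣) ↔ (Fin (suc k) ⊎ Fin (suc l))
  sum↔⊎ = mk↔ₛ′ to [ (λ a → zero , f.from a) , (λ b → suc zero , g.from b) ]′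
    (λ { (inj₁ a) → cong inj₁ (f.strictlyInverseˡ a) ; (inj₂ b) → cong inj₂ (g.strictlyInverseˡ b) })
    (λ { (zero , x) → cong (zero ,_) (f.strictlyInverseʳ x) ; (suc zero , y) → cong (suc zero ,_) (g.strictlyInverseʳ y) })

ℤ-locallyFinite : ∀ (x z : ℤ) → ∃[ ys ] ∀ y → x ℤ.< y → y ℤ.< z → y ∈ₗ ys
-- The list may overshoot the interval: it holds the nonnegative integers below `z` and the negative
-- ones above `x`.
ℤ-locallyFinite x z = mapₗ +_ (upTo (pos z)) ++ mapₗ -[1+_] (upTo (neg x)) , within
  where
  pos neg : ℤ → ℕ
  pos (+ n)    = n
  pos -[1+ _ ] = 0
  neg (+ _)    = 0
  neg -[1+ n ] = n
  within : ∀ y → x ℤ.< y → y ℤ.< z → y ∈ₗ (mapₗ +_ (upTo (pos z)) ++ mapₗ -[1+_] (upTo (neg x)))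
  within (+ k)    _ (ℤ.+<+ k<n) = ∈-++⁺ˡ (∈-map⁺ +_ (∈-upTo⁺ k<n))
  within -[1+ k ] (ℤ.-<- k<n) _ = ∈-++⁺ʳ _ (∈-map⁺ -[1+_] (∈-upTo⁺ k<n))

everything nowhere : {A : Set} → A → Bool
everything _ = true
nowhere _ = false

ωword : {A : Set} → Dir → (ℕ → A) → Word A
ωword d a = record { dom = ω d ; countable = ℕ-countable ; letter = a }

<⇒<-directed-ω : ∀ {d j k} → j ℕ.< k → LinearOrder._<_ (directed d (ω d)) j k
<⇒<-directed-ω {up}   j<k = j<k
<⇒<-directed-ω {down} j<k = j<k

-- The operations of Δₙ described by thresholds

module Values (n : ℕ) where

  Value : Set
  Value = Maybe (Fin (suc n))

  infix 4 _⊒_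
  -- A value is known from the thresholds that it reaches, so equations in Δₙ become pairs of
  -- implications by `⊒-ext`. The identity reaches none, which separates it from 0.
  _⊒_ : Value → ℕ → Set
  nothing ⊒ v = ⊥
  just i  ⊒ v = v ≤ toℕ i

  ⊒-bound : ∀ {x v} → x ⊒ v → v ≤ n
  ⊒-bound {just i} v≤i = ℕ.≤-trans v≤i (ℕ.≤-pred (Fin.toℕ<n i))

  ⊒-pred : ∀ {x v} → x ⊒ suc v → x ⊒ v
  ⊒-pred {just i} = ℕ.<⇒≤

  ⊒-≤ : ∀ {x u v} → u ≤ v → x ⊒ v → x ⊒ u
  ⊒-≤ {just i} = ℕ.≤-trans

  ⋣⇒nothing : ∀ {x} → ¬ x ⊒ 0 → x ≡ nothing
  ⋣⇒nothing {just i}  x⋣0 = contradiction z≤n x⋣0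
  ⋣⇒nothing {nothing} _   = refl

  ⊒-ext : ∀ {x y} → (∀ {v} → x ⊒ v → y ⊒ v) → (∀ {v} → y ⊒ v → x ⊒ v) → x ≡ y
  ⊒-ext {nothing} {nothing} _   _   = refl
  ⊒-ext {nothing} {just j}  _   y⇒x = ⊥-elim (y⇒x {0} z≤n)
  ⊒-ext {just i}  {nothing} x⇒y _   = ⊥-elim (x⇒y {0} z≤n)
  ⊒-ext {just i}  {just j}  x⇒y y⇒x = cong just (Fin.toℕ-injective (ℕ.≤-antisym (x⇒y ℕ.≤-refl) (y⇒x ℕ.≤-refl)))

  ⊒-exact : ∀ {x y v} → x ⊒ v → ¬ x ⊒ suc v → y ⊒ v → ¬ y ⊒ suc v → x ≡ y
  ⊒-exact {x} {y} {v} x⊒ x⋣ y⊒ y⋣ = ⊒-ext (transfer {x} {y} x⋣ y⊒) (transfer {y} {x} y⋣ x⊒)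
    where
    transfer : ∀ {x y u} → ¬ x ⊒ suc v → y ⊒ v → x ⊒ u → y ⊒ u
    transfer {x} {y} {u} x⋣ y⊒ x⊒u with u ℕ.≤? v
    ... | yes u≤v = ⊒-≤ {y} u≤v y⊒
    ... | no  u≰v = contradiction (⊒-≤ {x} (ℕ.≰⇒> u≰v) x⊒u) x⋣

  open ⊛Algebra (Δ n)

  ·-⊒⁻ : ∀ x y {v} → x · y ⊒ v → x ⊒ v ⊎ y ⊒ v
  ·-⊒⁻ nothing  y       y⊒ = inj₂ y⊒
  ·-⊒⁻ (just i) nothing x⊒ = inj₁ x⊒
  ·-⊒⁻ (just i) (just j) {v} ⊒v 
    rewrite Fin.toℕ-fromℕ< (ℕ.⊔-pres-<m (Fin.toℕ<n i) (Fin.toℕ<n j)) with ℕ.⊔-sel (toℕ i) (toℕ j)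
  ... | inj₁ eq = inj₁ (subst (v ≤_) eq ⊒v)
  ... | inj₂ eq = inj₂ (subst (v ≤_) eq ⊒v)

  ·-⊒⁺ : ∀ x y {v} → x ⊒ v ⊎ y ⊒ v → x · y ⊒ v
  ·-⊒⁺ nothing  y        (inj₂ y⊒) = y⊒
  ·-⊒⁺ (just i) nothing  (inj₁ x⊒) = x⊒
  ·-⊒⁺ (just i) (just j) ⊒v rewrite Fin.toℕ-fromℕ< (ℕ.⊔-pres-<m (Fin.toℕ<n i) (Fin.toℕ<n j)) =
    [ (λ v≤i → ℕ.≤-trans v≤i (ℕ.m≤m⊔n _ _)) , (λ v≤j → ℕ.≤-trans v≤j (ℕ.m≤n⊔m _ _)) ]′ ⊒v

  bump : Dir → Value → Value
  bump up   x = x ^τ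
  bump down x = x ^τ*

  bump-⊒⁻ : ∀ d x {v} → bump d x ⊒ suc v → x ⊒ v
  bump-⊒⁻ up (just i) {v} ⊒v rewrite Fin.toℕ-fromℕ< (s≤s (ℕ.m⊓n≤n (suc (toℕ i)) n)) = ℕ.≤-pred (ℕ.m≤n⊓o⇒m≤n _ _ ⊒v)
  bump-⊒⁻ down (just i) {v} ⊒v rewrite Fin.toℕ-fromℕ< (s≤s (ℕ.m⊓n≤n (suc (toℕ i)) n)) = ℕ.≤-pred (ℕ.m≤n⊓o⇒m≤n _ _ ⊒v)

  bump-⊒⁺ : ∀ d x {v} → x ⊒ v → suc v ≤ n → bump d x ⊒ suc v
  bump-⊒⁺ up   (just i) v≤i v<n rewrite Fin.toℕ-fromℕ< (s≤s (ℕ.m⊓n≤n (suc (toℕ i)) n)) = ℕ.⊓-glb (s≤s v≤i) v<n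
  bump-⊒⁺ down (just i) v≤i v<n rewrite Fin.toℕ-fromℕ< (s≤s (ℕ.m⊓n≤n (suc (toℕ i)) n)) = ℕ.⊓-glb (s≤s v≤i) v<n

  bump-⊒0 : ∀ d x → bump d x ⊒ 0 → x ⊒ 0
  bump-⊒0 up   (just i) _ = z≤n
  bump-⊒0 down (just i) _ = z≤n

  bump-⊒0⁺ : ∀ d x → x ⊒ 0 → bump d x ⊒ 0
  bump-⊒0⁺ up   (just i) _ = z≤n
  bump-⊒0⁺ down (just i) _ = z≤n

restrictW : ∀ {A : Set} (w : Word A) → Sub (dom w) → Word A
restrictW w P = record
  { dom       = restrict (dom w) P
  ; countable = mk↣ {to = Injection.to (countable w) ∘ proj₁} λ eq → T-ext (Injection.injective (countable w) eq)
  ; letter    = letter w ∘ proj₁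
  }
  where
  T-ext : ∀ {p q : ∣ restrict (dom w) P ∣} → proj₁ p ≡ proj₁ q → p ≡ q
  T-ext {x , _} refl = cong (x ,_) (T-irrelevant _ _)

-- Classical comprehension and subsequences

module Classical (em : ExcludedMiddle 1ℓ) where

  dec : (A : Set) → Dec A
  dec A = map′ lower lift (em {Lift 1ℓ A})

  em₁ : (A : Set₁) → Dec A
  em₁ A = em

  by-contradiction : {A : Set₁} → ¬ ¬ A → A
  by-contradiction {A} = decidable-stable (em₁ A)

  by-contradiction₀ : {A : Set} → ¬ ¬ A → A
  by-contradiction₀ {A} = decidable-stable (dec A)

  abstract
    -- Subsets are Boolean-valued, so excluded middle is what turns a predicate into a subset.
    ⟪_⟫ : {A : Set} → (A → Set) → A → Bool
    ⟪ P ⟫ x = ⌊ dec (P x) ⌋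

    ∈⁺ : {A : Set} {P : A → Set} {x : A} → P x → x ∈ ⟪ P ⟫
    ∈⁺ {P = P} {x} = fromWitness {a? = dec (P x)}

    ∈⁻ : {A : Set} {P : A → Set} {x : A} → x ∈ ⟪ P ⟫ → P x
    ∈⁻ {P = P} {x} = toWitness {a? = dec (P x)}

  infixr 7 _∩_
  _∩_ : {A : Set} → (A → Bool) → (A → Bool) → A → Bool
  P ∩ Q = ⟪ (λ x → x ∈ P × x ∈ Q) ⟫

  only : {A : Set} → A → A → Bool
  only x = ⟪ _≡ x ⟫

  Subsequence : (ℕ → Set) → Set
  Subsequence A = Σ[ φ ∈ (ℕ → ℕ) ] StrictlyMono φ × ∀ k → A (φ k)

  frequently⇒subsequence : ∀ {A} → (∀ N → ∃[ k ] N ≤ k × A k) → Subsequence A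
  frequently⇒subsequence {A} f = φ , strictlyMono φ (λ k → proj₁ (proj₂ (f (suc (φ k))))) , φ-A
    where
    φ : ℕ → ℕ
    φ zero    = proj₁ (f 0)
    φ (suc k) = proj₁ (f (suc (φ k)))
    φ-A : ∀ k → A (φ k)
    φ-A zero    = proj₂ (proj₂ (f 0))
    φ-A (suc k) = proj₂ (proj₂ (f (suc (φ k))))

  frequently? : ∀ A → Subsequence A ⊎ (∃[ N ] ∀ k → N ≤ k → ¬ A k)
  frequently? A with dec (∃[ N ] ∀ k → N ≤ k → ¬ A k)
  ... | yes p = inj₂ p
  ... | no ¬p = inj₁ (frequently⇒subsequence λ N → by-contradiction₀ λ ¬q →
                  ¬p (N , λ k N≤k a → ¬q (k , N≤k , a)))

  -- Additivity of depth; depth in finite and locally finite orderings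

  module _ {α : LinearOrder} {lev : ∣ α ∣ → ℕ → Set} where

    -- If infinitely many members of the sequence have a deep part in `P`, these parts form a
    -- sequence in `P`. Otherwise, from some index on, the induction hypothesis puts a deep part of
    -- every member into `Q`.
    Deep-∪ : ∀ {v P Q R} → (∀ {x} → x ∈ R → x ∈ P ⊎ x ∈ Q) → Deep α lev v R →
             Deep α lev v P ⊎ Deep α lev v Q
    Deep-∪ cover (point x x∈ l) = [ (λ p → inj₁ (point x p l)) , (λ q → inj₂ (point x q l)) ]′ (cover x∈)
    Deep-∪ {suc v} {P} {Q} cover (limit d R R⊆ inc dR)
      with frequently? (λ k → Deep α lev v (P ∩ R k))
    ... | inj₁ (φ , φ-mono , dP) =
      inj₁ (limit d (λ k → P ∩ R (φ k)) (λ _ → proj₁ ∘ ∈⁻)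
        (λ j<k x∈ y∈ → inc (φ-mono j<k) (proj₂ (∈⁻ x∈)) (proj₂ (∈⁻ y∈))) dP)
    ... | inj₂ (N , ¬dP) =
      inj₂ (limit d (λ k → Q ∩ R (N ℕ.+ k)) (λ _ → proj₁ ∘ ∈⁻)
        (λ j<k x∈ y∈ → inc (ℕ.+-monoʳ-< N j<k) (proj₂ (∈⁻ x∈)) (proj₂ (∈⁻ y∈)))
        (λ k → [ (λ dP → contradiction dP (¬dP (N ℕ.+ k) (ℕ.m≤m+n N k))) , id ]′
          (Deep-∪ (λ x∈ → [ (λ p → inj₁ (∈⁺ (p , x∈))) , (λ q → inj₂ (∈⁺ (q , x∈))) ]′ (cover (R⊆ _ x∈)))
                  (dR (N ℕ.+ k)))))

    -- Two members of a limit sequence supply two distinct points, so only a letter can make such a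
    -- set deep.
    Deep-subsingleton : ∀ {v P} → (∀ {x y} → x ∈ P → y ∈ P → x ≡ y) → Deep α lev v P →
                        ∃[ x ] x ∈ P × lev x v
    Deep-subsingleton single (point x x∈ l) = x , x∈ , l
    Deep-subsingleton single (limit d Q Q⊆ inc dQ) =
      let x , x∈ = Deep-nonempty (dQ 0)
          y , y∈ = Deep-nonempty (dQ 1)
      in ⊥-elim (LinearOrder.irrefl (directed d α) (single (Q⊆ 0 x∈) (Q⊆ 1 y∈)) (inc (s≤s z≤n) x∈ y∈))

    -- Additivity splits off one listed point at a time.
    Deep-finite : ∀ {v P} (xs : List ∣ α ∣) → (∀ {x} → x ∈ P → x ∈ₗ xs) → Deep α lev v P →
                  ∃[ x ] x ∈ P × lev x v
    Deep-finite [] cover dP with () ← cover (proj₂ (Deep-nonempty dP))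
    Deep-finite {P = P} (y ∷ ys) cover dP
      with Deep-∪ {P = only y ∩ P} {Q = ⟪ _∈ₗ ys ⟫ ∩ P}
             (λ x∈ → case cover x∈ of λ { (here eq)    → inj₁ (∈⁺ (∈⁺ eq , x∈))
                                        ; (there x∈ys) → inj₂ (∈⁺ (∈⁺ x∈ys , x∈)) }) dP
    ... | inj₂ d = let x , x∈ , l = Deep-finite ys (∈⁻ ∘ proj₁ ∘ ∈⁻) d in x , proj₂ (∈⁻ x∈) , l
    ... | inj₁ d =
      let x , x∈ , l = Deep-subsingleton
                         (λ a b → trans (∈⁻ (proj₁ (∈⁻ a))) (sym (∈⁻ (proj₁ (∈⁻ b))))) d
      in x , proj₂ (∈⁻ x∈) , l

    -- The second set of the sequence lies between points of the first and of the third.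
    Deep-locallyFinite : (∀ x z → ∃[ ys ] ∀ y → LinearOrder._<_ α x y → LinearOrder._<_ α y z → y ∈ₗ ys) →
                         ∀ {v P} → Deep α lev (suc v) P → ∃[ x ] x ∈ P × (lev x (suc v) ⊎ lev x v)
    Deep-locallyFinite fin (point x x∈ l) = x , x∈ , inj₁ l
    Deep-locallyFinite fin (limit d Q Q⊆ inc dQ) =
      let x , x∈ = Deep-nonempty (dQ 0)
          z , z∈ = Deep-nonempty (dQ 2)
          ys , y∈ys = between d x z
          y , y∈ , l = Deep-finite ys (λ y∈ → y∈ys _ (inc (s≤s z≤n) x∈ y∈) (inc (s≤s (s≤s z≤n)) y∈ z∈)) (dQ 1)
      in y , Q⊆ 1 y∈ , inj₂ l
      where
      between : ∀ d x z → ∃[ ys ] ∀ y → LinearOrder._<_ (directed d α) x y →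
                LinearOrder._<_ (directed d α) y z → y ∈ₗ ys
      between up   x z = fin x z
      between down x z = let ys , y∈ = fin z x in ys , λ y x>y y>z → y∈ y y>z x>y

  -- Transport of depth along maps between orderings

  image : {A B : Set} → (A → B) → (A → Bool) → B → Bool
  image g P = ⟪ (λ y → ∃[ x ] x ∈ P × g x ≡ y) ⟫

  fibre : {A B : Set} → (A → B) → B → A → Bool
  fibre g y = ⟪ (λ x → g x ≡ y) ⟫

  -- Substitution: the limits of a witness are kept, and each of its points `x` is replaced by a
  -- witness inside `F x`.
  Deep-bind : ∀ {α β lev lev′ v P P′} (F : ∣ α ∣ → Sub β) →
              (∀ {x y} → LinearOrder._<_ α x y → Before β (F x) (F y)) →
              (∀ {u x} → x ∈ P → lev x u → Deep β lev′ u (F x)) →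
              (∀ {x} → x ∈ P → F x ⊆ P′) →
              Deep α lev v P → Deep β lev′ v P′
  Deep-bind F mono deep F⊆ (point x x∈ l) = Deep-⊆ (F⊆ x∈) (deep x∈ l)
  Deep-bind {α} {β} F mono deep F⊆ (limit d Q Q⊆ inc dQ) = limit d
    (λ k → ⟪ (λ y → ∃[ x ] x ∈ Q k × y ∈ F x) ⟫)
    (λ k y∈ → let x , x∈ , y∈F = ∈⁻ y∈ in F⊆ (Q⊆ k x∈) y∈F)
    (λ j<k y∈ z∈ → let x , x∈ , y∈F = ∈⁻ y∈
                       x′ , x′∈ , z∈F = ∈⁻ z∈
                   in mono′ d (inc j<k x∈ x′∈) y∈F z∈F)
    (λ k → Deep-bind F mono (deep ∘ Q⊆ k) (λ x∈ y∈ → ∈⁺ (_ , x∈ , y∈)) (dQ k))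
    where
    mono′ : ∀ d {x y} → LinearOrder._<_ (directed d α) x y → Before (directed d β) (F x) (F y)
    mono′ up   x<y   = mono x<y
    mono′ down y<x a b = mono y<x b a

  Deep-map : ∀ {α β lev lev′ v P P′} (f : ∣ α ∣ → ∣ β ∣) →
             (∀ {x y} → LinearOrder._<_ α x y → LinearOrder._<_ β (f x) (f y)) →
             (∀ {x} → x ∈ P → f x ∈ P′) →
             (∀ {u x} → x ∈ P → lev x u → lev′ (f x) u) →
             Deep α lev v P → Deep β lev′ v P′
  Deep-map {β = β} {P′ = P′} f mono f∈ deep = Deep-bind (λ x → only (f x))
    (λ x<y a∈ b∈ → subst₂ (LinearOrder._<_ β) (sym (∈⁻ a∈)) (sym (∈⁻ b∈)) (mono x<y))
    (λ x∈ l → point _ (∈⁺ refl) (deep x∈ l))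
    (λ x∈ y∈ → subst (_∈ P′) (sym (∈⁻ y∈)) (f∈ x∈))

  module _ (α : LinearOrder) where
    open LinearOrder α

    ≮-<-trans : ∀ {x y z} → ¬ y < x → y < z → x < z
    ≮-<-trans {x} {y} y≮x y<z with compare x y
    ... | tri< x<y _ _  = <-trans x<y y<z
    ... | tri≈ _ refl _ = y<z
    ... | tri> _ _ y<x  = contradiction y<x y≮x

    <-≮-trans : ∀ {x y z} → x < y → ¬ z < y → x < z
    <-≮-trans {y = y} {z} x<y z≮y with compare y z
    ... | tri< y<z _ _  = <-trans x<y y<z
    ... | tri≈ _ refl _ = x<y
    ... | tri> _ _ z<y  = contradiction z<y z≮y

    ≮-antisym : ∀ {x y} → ¬ x < y → ¬ y < x → x ≡ y
    ≮-antisym {x} {y} x≮y y≮x with compare x y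
    ... | tri< x<y _ _ = contradiction x<y x≮y
    ... | tri≈ _ eq _  = eq
    ... | tri> _ _ y<x = contradiction y<x y≮x

  -- A partial inverse of `Deep-bind` for weakly increasing `g`: depth inside one fibre is charged
  -- to the letter of its image, and the remaining limits survive. The bound `u ≤ v` admits letters
  -- whose values are capped, as in Δₙ.
  Deep-collapse : ∀ {α β lev lev′} (g : ∣ α ∣ → ∣ β ∣) →
                  (∀ {x y} → LinearOrder._<_ α x y → ¬ LinearOrder._<_ β (g y) (g x)) →
                  ∀ {v P} → (∀ {u} b → u ≤ v → Deep α lev u (fibre g b) → lev′ b u) →
                  Deep α lev v P → Deep β lev′ v (image g P)
  Deep-collapse g mono deep (point x x∈ l) =
    point (g x) (∈⁺ (x , x∈ , refl)) (deep (g x) ℕ.≤-refl (point x (∈⁺ refl) l))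
  Deep-collapse {α} {β} {lev′ = lev′} g mono {suc v} deep (limit d Q Q⊆ inc dQ) =
    cases (dec (∃[ N ] ∀ k → N ≤ k → i k ≡ i N))
    where
    open LinearOrder (directed d β) using (_<_)
    q : ∀ k → ∣ α ∣
    q k = proj₁ (Deep-nonempty (dQ k))
    q∈ : ∀ k → q k ∈ Q k
    q∈ k = proj₂ (Deep-nonempty (dQ k))
    i : ℕ → ∣ β ∣
    i k = g (q k)
    mono′ : ∀ d {x y} → LinearOrder._<_ (directed d α) x y → ¬ LinearOrder._<_ (directed d β) (g y) (g x)
    mono′ up   = mono
    mono′ down = mono

    -- Each such point lies between `q N` and the chosen point of the next member; both have image
    -- `i N`, so weak monotonicity squeezes its image.
    in-fibre : ∀ {N} → (∀ k → N ≤ k → i k ≡ i N) → ∀ k {x} → x ∈ Q (suc N ℕ.+ k) → g x ≡ i N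
    in-fibre {N} constant k {x} x∈ = ≮-antisym (directed d β)
      (mono′ d (inc (s≤s (ℕ.m≤m+n N k)) (q∈ N) x∈))
      (subst (λ b → ¬ b < g x)
        (constant (suc (suc N ℕ.+ k)) (ℕ.m≤n⇒m≤1+n (ℕ.m≤n⇒m≤1+n (ℕ.m≤m+n N k))))
        (mono′ d (inc ℕ.≤-refl x∈ (q∈ _))))

    module Unbounded (¬constant : ¬ (∃[ N ] ∀ k → N ≤ k → i k ≡ i N)) where

      later : ∀ N → ∃[ k ] N ≤ k × i N < i k
      later N = by-contradiction₀ λ none → ¬constant (N , λ k N≤k → equal none (ℕ.m≤n⇒m<n∨m≡n N≤k))
        where
        equal : ¬ (∃[ k ] N ≤ k × i N < i k) → ∀ {k} → N ℕ.< k ⊎ N ≡ k → i k ≡ i N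
        equal none (inj₂ refl) = refl
        equal none (inj₁ N<k)  = ≮-antisym (directed d β) (mono′ d (inc N<k (q∈ _) (q∈ _)))
                                   (λ lt → none (_ , ℕ.<⇒≤ N<k , lt))

      next : ℕ → ℕ
      next N = proj₁ (later N)

      φ : ℕ → ℕ
      φ zero    = 0
      -- Between two selected members remain `suc (φ k)` and `next (suc (φ k))`; the strict increase
      -- of `i` from the former to the latter separates the images.
      φ (suc k) = suc (next (suc (φ k)))

      φ-mono : StrictlyMono φ
      φ-mono = strictlyMono φ (λ k → s≤s (ℕ.<⇒≤ (proj₁ (proj₂ (later (suc (φ k)))))))

      separated : ∀ {j k x y} → j ℕ.< k → x ∈ Q (φ j) → y ∈ Q (φ k) → g x < g y
      separated {j} j<k x∈ y∈ = <-≮-trans (directed d β)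
        (≮-<-trans (directed d β) (mono′ d (inc ℕ.≤-refl x∈ (q∈ (suc (φ j))))) (proj₂ (proj₂ (later (suc (φ j))))))
        (mono′ d (inc (StrictlyMono⇒≤ φ-mono j<k) (q∈ (next (suc (φ j)))) y∈))

    -- Eventually, either all the sets lie in one fibre, or a sparse subsequence has images
    -- that no longer touch.
    cases : Dec (∃[ N ] ∀ k → N ≤ k → i k ≡ i N) → Deep β lev′ (suc v) (image g _)
    cases (yes (N , constant)) = point (i N) (∈⁺ (q N , Q⊆ N (q∈ N) , refl))
      (deep (i N) ℕ.≤-refl (limit d (λ k → Q (suc N ℕ.+ k)) (λ k x∈ → ∈⁺ (in-fibre constant k x∈))
                             (λ j<k → inc (ℕ.+-monoʳ-< (suc N) j<k)) (λ k → dQ (suc N ℕ.+ k))))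
    cases (no ¬constant) = limit d (λ k → image g (Q (φ k)))
      (λ k b∈ → let x , x∈ , eq = ∈⁻ b∈ in ∈⁺ (x , Q⊆ _ x∈ , eq))
      (λ j<k a∈ b∈ → let x , x∈ , a≡ = ∈⁻ a∈
                         y , y∈ , b≡ = ∈⁻ b∈
                     in subst₂ _<_ a≡ b≡ (separated j<k x∈ y∈))
      (λ k → Deep-collapse g mono (λ b u≤v → deep b (ℕ.m≤n⇒m≤1+n u≤v)) (dQ (φ k)))
      where open Unbounded ¬constant


  binary : {A : Set} → A → A → Fin 2 → A
  binary x y zero       = x
  binary x y (suc zero) = y

  binaryPartition : ∀ {α R P Q} → (∀ {x} → x ∈ R → x ∈ P ⊎ x ∈ Q) → P ⊆ R → Q ⊆ R → Before α P Q →
                    Partition α (finₒ 2) R (binary P Q)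
  binaryPartition cov P⊆ Q⊆ P<Q = record
    { parts   = λ { zero → P⊆ ; (suc zero) → Q⊆ }
    ; cover   = λ x∈ → [ (zero ,_) , (suc zero ,_) ]′ (cov x∈)
    ; ordered = λ { {zero} {zero} () ; {zero} {suc zero} _ → P<Q ; {suc zero} {zero} () ; {suc zero} {suc zero} (s≤s ()) }
    }

  -- Sets that are not deep

  -- An induction principle: a family `S` with these closure properties contains at level `v` every
  -- set that is not deep of level `v`.
  module Structure
    (α : LinearOrder) (countable : Countable ∣ α ∣) (lev : ∣ α ∣ → ℕ → Set)
    (S : ℕ → Sub α → Set₁)
    (S-zero  : ∀ {P} → (∀ {x} → x ∈ P → ¬ lev x 0) → S 0 P)
    (S-small : ∀ {v P} → (∀ {x y} → x ∈ P → y ∈ P → x ≡ y) → (∀ {x} → x ∈ P → ¬ lev x v) → S v P)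
    (S-add   : ∀ {v R} Q → Partition α (finₒ 2) R Q → (∀ i → S v (Q i)) → S v R)
    (S-ω     : ∀ {v R} d Q → Partition α (ω d) R Q → (∀ k → S v (Q k)) → S (suc v) R)
    where

    -- `S` is not assumed closed under subsets, but the argument keeps cutting sets into pieces;
    -- quantifying over subsets makes the induction go through.
    record Hereditary (v : ℕ) (P : Sub α) : Set₁ where
      constructor hereditarily
      field on : ∀ Q → Q ⊆ P → S v Q

    open Hereditary

    Hereditary-⊆ : ∀ {v P Q} → Q ⊆ P → Hereditary v P → Hereditary v Q
    Hereditary-⊆ Q⊆P h = hereditarily λ R R⊆Q → h .on R (Q⊆P ∘ R⊆Q)

    Hereditary-add : ∀ {v P Q R} → (∀ {x} → x ∈ R → x ∈ P ⊎ x ∈ Q) → Before α P Q →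
                     Hereditary v P → Hereditary v Q → Hereditary v R
    Hereditary-add {P = P} {Q} cov P<Q hP hQ = hereditarily λ R′ R′⊆ → S-add (binary (R′ ∩ P) (R′ ∩ Q))
      (binaryPartition (λ x∈ → [ (λ p → inj₁ (∈⁺ (x∈ , p))) , (λ q → inj₂ (∈⁺ (x∈ , q))) ]′ (cov (R′⊆ x∈)))
                       (proj₁ ∘ ∈⁻) (proj₁ ∘ ∈⁻) (λ x∈ y∈ → P<Q (proj₂ (∈⁻ x∈)) (proj₂ (∈⁻ y∈))))
      (λ { zero → hP .on _ (proj₂ ∘ ∈⁻) ; (suc zero) → hQ .on _ (proj₂ ∘ ∈⁻) })

    module _ {v : ℕ} (IH : ∀ {P} → ¬ Deep α lev v P → Hereditary v P) where

      -- The one-sided case, in direction `d`: a set none of whose final segments is hereditary must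
      -- be empty if it is not deep. Countability provides a cofinal sequence that cuts it into
      -- ω-many blocks.
      module Tail (d : Dir) (M : Sub α) (¬deep : ¬ Deep α lev (suc v) M) where
        open LinearOrder (directed d α) using (_<_; irrefl; <-trans; compare)

        from : ∣ α ∣ → Sub α
        from x = ⟪ (λ y → y ∈ M × ¬ y < x) ⟫

        module _ (bad : ∀ {x} → x ∈ M → ¬ Hereditary (suc v) (from x)) {x₀} (x₀∈ : x₀ ∈ M) where

          code : ∣ α ∣ → ℕ
          code = Injection.to countable

          next : ℕ → ∣ α ∣ → Set
          next k x = ∃[ y ] y ∈ M × code y ≡ k × x < y

          climb : ∀ k x → Dec (next k x) → ∣ α ∣
          climb k x (yes (y , _)) = y
          climb k x (no _)        = x

          -- A weakly increasing sequence cofinal in M, since every element of M has a code.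
          cofinal : ℕ → ∣ α ∣
          cofinal zero    = x₀
          cofinal (suc k) = climb k (cofinal k) (dec (next k (cofinal k)))

          cofinal-∈ : ∀ k → cofinal k ∈ M
          cofinal-∈ zero = x₀∈
          cofinal-∈ (suc k) with dec (next k (cofinal k))
          ... | yes (_ , y∈ , _) = y∈
          ... | no _             = cofinal-∈ k

          cofinal-step : ∀ k → ¬ cofinal (suc k) < cofinal k
          cofinal-step k with dec (next k (cofinal k))
          ... | yes (_ , _ , _ , x<y) = λ y<x → irrefl refl (<-trans x<y y<x)
          ... | no _                  = irrefl refl

          cofinal-mono : ∀ {j k} → j ≤ k → ¬ cofinal k < cofinal j
          cofinal-mono = go ∘ ℕ.≤⇒≤′
            where
            go : ∀ {j k} → j ≤′ k → ¬ cofinal k < cofinal j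
            go ≤′-refl                    = irrefl refl
            go {j} (≤′-step {n = k} j≤k) lt = cofinal-step k (<-≮-trans (directed d α) lt (go j≤k))

          cofinal-code : ∀ {y} → y ∈ M → ¬ cofinal (suc (code y)) < y
          cofinal-code {y} y∈ with dec (next (code y) (cofinal (code y)))
          ... | yes (z , _ , eq , _) = irrefl (Injection.injective countable eq)
          ... | no none              = λ lt → none (y , y∈ , refl , lt)

          -- A last point `y` would make `from y` a singleton without a letter of level `v + 1`,
          -- hence hereditary by `S-small`.
          unbounded : ∀ {y} → y ∈ M → ∃[ z ] z ∈ M × y < z
          unbounded {y} y∈ = by-contradiction₀ λ none →
            let max : ∀ {z} → z ∈ from y → z ≡ y
                max z∈ = let z∈M , z≮y = ∈⁻ z∈ in ≮-antisym (directed d α) z≮y (λ y<z → none (_ , z∈M , y<z))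
            in bad y∈ (hereditarily λ Q Q⊆ → S-small (λ a b → trans (max (Q⊆ a)) (sym (max (Q⊆ b))))
                 (λ a l → ¬deep (point _ (proj₁ (∈⁻ (Q⊆ a))) l)))

          overtaken : ∀ {y} → y ∈ M → ∃[ k ] y < cofinal k
          overtaken y∈ = let z , z∈ , y<z = unbounded y∈ in
            suc (code z) , <-≮-trans (directed d α) y<z (cofinal-code z∈)

          block : ℕ → Sub α
          block k = ⟪ (λ y → y ∈ M × ¬ y < cofinal k × y < cofinal (suc k)) ⟫

          block-increasing : Increasing (directed d α) block
          block-increasing j<k x∈ y∈ =
            let _ , _ , x< = ∈⁻ x∈
                _ , y≮ , _ = ∈⁻ y∈
            in <-≮-trans (directed d α) (<-≮-trans (directed d α) x< (cofinal-mono j<k)) y≮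

          block-cover : ∀ N {y} → y ∈ M → ¬ y < cofinal N → ∃[ k ] y ∈ block (N ℕ.+ k)
          block-cover N {y} y∈ y≮ = let k , y< = overtaken y∈ in
            go k (<-≮-trans (directed d α) y< (cofinal-mono (ℕ.m≤n+m k N)))
            where
            go : ∀ k → y < cofinal (N ℕ.+ k) → ∃[ k ] y ∈ block (N ℕ.+ k)
            go zero    lt = contradiction (subst (λ m → y < cofinal m) (ℕ.+-identityʳ N) lt) y≮
            go (suc k) lt with dec (y < cofinal (N ℕ.+ k))
            ... | yes y<  = go k y<
            ... | no  y≮′ = k , ∈⁺ (y∈ , y≮′ , subst (λ m → y < cofinal m) (ℕ.+-suc N k) lt)

          -- Infinitely many blocks deep of level `v` would make `M` deep of level `v + 1`.
          -- Otherwise the blocks from some `N` on fall under the induction hypothesis, and `S-ω`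
          -- makes the final segment from `cofinal N` hereditary, against `bad`.
          impossible : ⊥
          impossible with frequently? (λ k → Deep α lev v (block k))
          ... | inj₁ (φ , φ-mono , deep) =
            ¬deep (limit d (block ∘ φ) (λ _ → proj₁ ∘ ∈⁻) (λ j<k → block-increasing (φ-mono j<k)) deep)
          ... | inj₂ (N , shallow) = bad (cofinal-∈ N) (hereditarily λ R R⊆ →
            S-ω d (λ k → R ∩ block (N ℕ.+ k))
              (record
                { parts   = λ _ → proj₁ ∘ ∈⁻
                ; cover   = λ x∈ → let x∈M , x≮ = ∈⁻ (R⊆ x∈)
                                       k , x∈B = block-cover N x∈M x≮
                                   in k , ∈⁺ (x∈ , x∈B)
                ; ordered = increasing⇒ordered {α} d (λ j<k x∈ y∈ →
                    block-increasing (ℕ.+-monoʳ-< N j<k) (proj₂ (∈⁻ x∈)) (proj₂ (∈⁻ y∈)))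
                })
              (λ k → IH (shallow (N ℕ.+ k) (ℕ.m≤m+n N k)) .on _ (proj₂ ∘ ∈⁻)))

        ⇒Hereditary : (∀ {x} → x ∈ M → ¬ Hereditary (suc v) (from x)) → Hereditary (suc v) M
        ⇒Hereditary bad = hereditarily λ Q Q⊆ →
          -- A point of `Q` would start the impossible sequence, so `Q` is empty and both premises
          -- of `S-small` are vacuous.
          S-small (λ x∈ → ⊥-elim (impossible bad (Q⊆ x∈))) (λ x∈ → ⊥-elim (impossible bad (Q⊆ x∈)))

      -- If P failed, then so would every final segment of L or every initial segment of R.
      module Split (P : Sub α) (¬deep : ¬ Deep α lev (suc v) P) where
        open LinearOrder α

        above : ∣ α ∣ → Sub α
        above x = ⟪ (λ y → y ∈ P × ¬ y < x) ⟫

        above-⊆ : ∀ {x y} → y < x → above x ⊆ above y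
        above-⊆ y<x z∈ = let z∈P , z≮x = ∈⁻ z∈ in ∈⁺ (z∈P , λ z<y → z≮x (<-trans z<y y<x))

        -- Moving `x` up shrinks `above x`, so `good` is upward closed; this puts `L` before `R`.
        good : Sub α
        good x = ⌊ em₁ (Hereditary (suc v) (above x)) ⌋

        L R : Sub α
        L = ⟪ (λ x → x ∈ P × ¬ x ∈ good) ⟫
        R = P ∩ good

        split : ∀ {x} → x ∈ P → x ∈ L ⊎ x ∈ R
        split {x} x∈ with dec (x ∈ good)
        ... | yes g = inj₂ (∈⁺ (x∈ , g))
        ... | no ¬g = inj₁ (∈⁺ (x∈ , ¬g))

        L<R : Before α L R
        L<R {x} {y} x∈ y∈ with compare x y
        ... | tri< x<y _ _  = x<y
        ... | tri≈ _ refl _ = contradiction (proj₂ (∈⁻ y∈)) (proj₂ (∈⁻ x∈))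
        ... | tri> _ _ y<x  = contradiction
          (fromWitness {a? = em₁ _} (Hereditary-⊆ (above-⊆ y<x) (toWitness {a? = em₁ _} (proj₂ (∈⁻ y∈)))))
          (proj₂ (∈⁻ x∈))

        -- Suppose not. An initial segment of `R` up to `x` that was hereditary could be completed
        -- by points of the hereditary set `above x`, making `R` hereditary; so none is, and `Tail`
        -- applies downwards.
        hereditary-R : Hereditary (suc v) R
        hereditary-R = by-contradiction λ bad → bad (Tail.⇒Hereditary down R (¬deep ∘ Deep-⊆ (proj₁ ∘ ∈⁻))
          λ x∈ h → bad (rejoin x∈ h))
          where
          rejoin : ∀ {x} → x ∈ R → Hereditary (suc v) ⟪ (λ y → y ∈ R × ¬ x < y) ⟫ → Hereditary (suc v) R
          rejoin {x} x∈ h = Hereditary-add {P = ⟪ (λ y → y ∈ R × y < x) ⟫} {Q = ⟪ (λ y → y ∈ R × ¬ y < x) ⟫}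
            (λ {y} y∈ → case dec (y < x) of λ { (yes y<x) → inj₁ (∈⁺ (y∈ , y<x)) ; (no y≮x) → inj₂ (∈⁺ (y∈ , y≮x)) })
            (λ a b → <-≮-trans α (proj₂ (∈⁻ a)) (proj₂ (∈⁻ b)))
            (Hereditary-⊆ (λ y∈ → let y∈R , y<x = ∈⁻ y∈ in ∈⁺ (y∈R , asym y<x)) h)
            (Hereditary-⊆ (λ y∈ → let y∈R , y≮x = ∈⁻ y∈ in ∈⁺ (proj₁ (∈⁻ y∈R) , y≮x))
              (toWitness {a? = em₁ (Hereditary (suc v) (above x))} (proj₂ (∈⁻ x∈))))

        -- A hereditary final segment of `L` from `x`, followed by `R`, would make `above x`
        -- hereditary, although `x` is not `good`.
        hereditary-L : Hereditary (suc v) L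
        hereditary-L = Tail.⇒Hereditary up L (¬deep ∘ Deep-⊆ (proj₁ ∘ ∈⁻)) λ x∈ h →
          proj₂ (∈⁻ x∈) (fromWitness {a? = em₁ _} (rejoin h))
          where
          rejoin : ∀ {x} → Hereditary (suc v) ⟪ (λ y → y ∈ L × ¬ y < x) ⟫ → Hereditary (suc v) (above x)
          rejoin h = Hereditary-add
            (λ y∈ → let y∈P , y≮x = ∈⁻ y∈ in [ (λ y∈L → inj₁ (∈⁺ (y∈L , y≮x))) , inj₂ ]′ (split y∈P))
            (λ a b → L<R (proj₁ (∈⁻ a)) b) h hereditary-R

        hereditary : Hereditary (suc v) P
        hereditary = Hereditary-add split L<R hereditary-L hereditary-R

    ¬Deep⇒Hereditary : ∀ {v P} → ¬ Deep α lev v P → Hereditary v P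
    ¬Deep⇒Hereditary {zero}  ¬deep = hereditarily λ Q Q⊆ → S-zero λ x∈ l → ¬deep (point _ (Q⊆ x∈) l)
    ¬Deep⇒Hereditary {suc v} ¬deep = Split.hereditary (λ ¬d → ¬Deep⇒Hereditary {v} ¬d) _ ¬deep

    ¬Deep⇒S : ∀ {v P} → ¬ Deep α lev v P → S v P
    ¬Deep⇒S ¬deep = ¬Deep⇒Hereditary ¬deep .on _ id


  -- Depth in ordered sums

  Deep-summand : ∀ {ι α lev u i} → Deep (sumₒ ι α) lev u (fibre proj₁ i) →
                 Deep (α i) (λ x → lev (i , x)) u everything
  -- The relation `p ≡ (i , y)` replaces a second projection, which would have to be transported
  -- along the equation of indices.
  Deep-summand {ι} {α} {lev} {i = i} = Deep-bind (λ p → ⟪ (λ y → p ≡ (i , y)) ⟫)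
    (λ p<q a b → ordered′ p<q (∈⁻ a) (∈⁻ b))
    (λ p∈ l → place (∈⁻ p∈) l) _
    where
    ordered′ : ∀ {p q} → _<ˡᵉˣ_ ι α p q → ∀ {x y} → p ≡ (i , x) → q ≡ (i , y) → LinearOrder._<_ (α i) x y
    ordered′ (inter i<i) refl refl = ⊥-elim (LinearOrder.irrefl ι refl i<i)
    ordered′ (intra x<y) refl refl = x<y
    place : ∀ {p u} → proj₁ p ≡ i → lev p u → Deep (α i) (λ x → lev (i , x)) u ⟪ (λ y → p ≡ (i , y)) ⟫
    place refl l = point _ (∈⁺ refl) l

  Deep-sum : ∀ {ι α lev v P} → Deep (sumₒ ι α) lev v P →
             Deep ι (λ i u → Deep (α i) (λ x → lev (i , x)) u everything) v everything
  Deep-sum {ι} d = Deep-⊆ _ (Deep-collapse proj₁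
    (λ { (inter i<j) j<i → LinearOrder.asym ι i<j j<i ; (intra _) i<i → LinearOrder.irrefl ι refl i<i })
    (λ i _ → Deep-summand) d)

  -- Infinitary rank

  -- Deep α rank₀ j P expresses that P has infinitary rank at least j.
  rank₀ : {A : Set} → A → ℕ → Set
  rank₀ _ v = v ≡ 0

  -- By `Deep-sum` depth passes to the word of depths of the summands. A finite index ordering then
  -- yields a summand of full depth, and ℤ, being locally finite, one that lost at most one level.
  𝓘⇒¬Deep : ∀ {n α} → 𝓘 n α → ∀ {P} → ¬ Deep α rank₀ (suc n) P
  𝓘⇒¬Deep (finite k f) deep
    with () ← proj₂ (proj₂ (Deep-finite (mapₗ (Inverse.from f) (allFin _))
                (λ {x} _ → subst (_∈ₗ _) (Inverse.strictlyInverseʳ f x)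
                           (∈-map⁺ (Inverse.from f) (∈-allFin (Inverse.to f x)))) deep))
  𝓘⇒¬Deep (ℤ-sum α rank e _) deep
    with i , _ , l ← Deep-locallyFinite ℤ-locallyFinite
                       (Deep-sum {ℤₒ} {α} (Deep-map {P′ = everything} (_≃_.to e) (_≃_.mono e) _ (λ _ → id) deep))
    with rank i
  ... | inj₁ r     = 𝓘⇒¬Deep r ([ Deep-pred (λ ()) , id ]′ l)
  ... | inj₂ empty = empty (proj₁ ([ Deep-nonempty , Deep-nonempty ]′ l))
  𝓘⇒¬Deep (fin-sum k α rank e) deep =
    let i , _ , l = Deep-finite (allFin _) (λ {i} _ → ∈-allFin i)
                      (Deep-sum {finₒ (suc k)} {α} (Deep-map {P′ = everything} (_≃_.to e) (_≃_.mono e) _ (λ _ → id) deep))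
    in 𝓘⇒¬Deep (rank i) l

  module _ (α : LinearOrder) where

    AtMost : ℕ → Sub α → Set₁
    AtMost n P = 𝓘 n (restrict α P) ⊎ ¬ ∣ restrict α P ∣

    -- Shifted by one to match sets that are not deep of level `v`: level 0 leaves only the empty
    -- set, and since the classes 𝓘 contain nonempty orderings only, emptiness is an extra case at
    -- the other levels.
    RankBelow : ℕ → Sub α → Set₁
    RankBelow zero    P = Lift 1ℓ (¬ ∣ restrict α P ∣)
    RankBelow (suc n) P = AtMost n P

    -- An ω- or ω*-sum is a ℤ-sum with one half empty.
    𝓘-limit : ∀ {n R} d Q → Partition α (ω d) R Q → (∀ k → AtMost n (Q k)) →
              ∣ restrict α R ∣ → 𝓘 (suc n) (restrict α R)
    𝓘-limit {n} {R} up Q p rank x = ℤ-sum (λ i → restrict α (Qℤ i)) rankℤ (restrict-≃ pℤ) x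
      where
      Qℤ : ℤ → Sub α
      Qℤ (+ k)    = Q k
      Qℤ -[1+ _ ] = nowhere
      rankℤ : ∀ i → AtMost n (Qℤ i)
      rankℤ (+ k)    = rank k
      rankℤ -[1+ _ ] = inj₂ proj₂
      pℤ : Partition α ℤₒ R Qℤ
      pℤ = record
        { parts   = λ { (+ k) → p .parts k ; -[1+ _ ] () }
        ; cover   = λ x∈ → let k , x∈Q = p .cover x∈ in + k , x∈Q
        ; ordered = λ { {+ _} {+ _} (ℤ.+<+ j<k) → p .ordered j<k ; { -[1+ _ ] } _ () ; {_} { -[1+ _ ] } _ _ () }
        }
    𝓘-limit {n} {R} down Q p rank x = ℤ-sum (λ i → restrict α (Qℤ i)) rankℤ (restrict-≃ pℤ) x
      where
      Qℤ : ℤ → Sub α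
      Qℤ (+ _)    = nowhere
      Qℤ -[1+ k ] = Q k
      rankℤ : ∀ i → AtMost n (Qℤ i)
      rankℤ (+ _)    = inj₂ proj₂
      rankℤ -[1+ k ] = rank k
      pℤ : Partition α ℤₒ R Qℤ
      pℤ = record
        { parts   = λ { (+ _) () ; -[1+ k ] → p .parts k }
        ; cover   = λ x∈ → let k , x∈Q = p .cover x∈ in -[1+ k ] , x∈Q
        ; ordered = λ { { -[1+ _ ] } { -[1+ _ ] } (ℤ.-<- j<k) → p .ordered j<k ; {+ _} _ () ; {_} {+ _} _ _ () }
        }

    RankBelow-ω : ∀ {v R} d Q → Partition α (ω d) R Q → (∀ k → RankBelow v (Q k)) → RankBelow (suc v) R
    RankBelow-ω {zero} d Q p rank = inj₂ λ (x , x∈) → let k , x∈Q = p .cover x∈ in lower (rank k) (x , x∈Q)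
    RankBelow-ω {suc v} {R} d Q p rank with dec ∣ restrict α R ∣
    ... | yes x    = inj₁ (𝓘-limit d Q p rank x)
    ... | no empty = inj₂ empty

    -- The classes grow with their index: pad a single part to an ω-sum by empty ones.
    RankBelow-suc : ∀ {v P} → RankBelow (suc v) P → RankBelow (suc (suc v)) P
    RankBelow-suc {v} {P} rank = RankBelow-ω up Q
      (record { parts = λ { zero → id ; (suc _) () } ; cover = λ x∈ → 0 , x∈ ; ordered = λ { {_} {suc _} _ _ () } })
      (λ { zero → rank ; (suc _) → inj₂ proj₂ })
      where
      Q : ℕ → Sub α
      Q zero    = P
      Q (suc _) = nowhere

    RankBelow-small : ∀ {v P} → (∀ {x y} → x ∈ P → y ∈ P → x ≡ y) → (∀ {x} → x ∈ P → ¬ rank₀ x v) → RankBelow v P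
    RankBelow-small {zero} _ empty = lift λ (x , x∈) → empty x∈ refl
    RankBelow-small {suc zero} {P} single _ with dec ∣ restrict α P ∣
    ... | no empty   = inj₂ empty
    ... | yes (x , x∈) = inj₁ (finite 0 (mk↔ₛ′ (λ _ → zero) (λ _ → x , x∈) (λ { zero → refl }) only-x))
      where
      only-x : ∀ p → (x , x∈) ≡ p
      only-x (y , y∈) with single {x} {y} x∈ y∈
      ... | refl = cong (x ,_) (T-irrelevant _ _)
    RankBelow-small {suc (suc v)} single small =
      RankBelow-suc {v} (RankBelow-small {suc v} single (λ _ ()))

    -- Empty parts are discarded first. Two nonempty parts form a finite ordering at rank 0 and a
    -- `fin-sum` above it.
    RankBelow-add : ∀ {v R} Q → Partition α (finₒ 2) R Q → (∀ i → RankBelow v (Q i)) → RankBelow v R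
    RankBelow-add {zero} Q p rank = lift λ (x , x∈) → let i , x∈Q = p .cover x∈ in lower (rank i) (x , x∈Q)
    RankBelow-add {suc v} {R} Q p rank with rank zero | rank (suc zero)
    ... | inj₂ empty₀ | rank₁ = [ inj₁ ∘ 𝓘-resp-≃ (restrict-cong (p .parts _) in₁)
                                , (λ empty₁ → inj₂ λ (x , x∈) → empty₁ (x , in₁ x∈)) ]′ rank₁
      where
      in₁ : R ⊆ Q (suc zero)
      in₁ x∈ with p .cover x∈
      ... | zero     , x∈Q = contradiction (_ , x∈Q) empty₀
      ... | suc zero , x∈Q = x∈Q
    ... | inj₁ rank₀′ | inj₂ empty₁ = inj₁ (𝓘-resp-≃ (restrict-cong (p .parts _) in₀) rank₀′)
      where
      in₀ : R ⊆ Q zero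
      in₀ x∈ with p .cover x∈
      ... | zero     , x∈Q = x∈Q
      ... | suc zero , x∈Q = contradiction (_ , x∈Q) empty₁
    ... | inj₁ rank₀′ | inj₁ rank₁ = inj₁ (both v rank₀′ rank₁)
      where
      ranks : ∀ {v} → 𝓘 v (restrict α (Q zero)) → 𝓘 v (restrict α (Q (suc zero))) → ∀ i → 𝓘 v (restrict α (Q i))
      ranks r s zero       = r
      ranks r s (suc zero) = s
      both : ∀ v → 𝓘 v (restrict α (Q zero)) → 𝓘 v (restrict α (Q (suc zero))) → 𝓘 v (restrict α R)
      both zero    r s = finite-sum p (ranks r s)
      both (suc v) r s = fin-sum 1 _ (ranks r s) (restrict-≃ p)

    module _ (countable : Countable ∣ α ∣) where
      open Structure α countable rank₀ RankBelow
        (λ {P} empty → lift λ (x , x∈) → empty x∈ refl) RankBelow-small RankBelow-add RankBelow-ω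

      -- Otherwise `X` would be empty or belong to the preceding class, against the minimality of
      -- its rank.
      HasRank⇒Deep : ∀ {X j} → HasRank (restrict α X) j → Deep α rank₀ j X
      HasRank⇒Deep {X} {j} (rank , least) = by-contradiction₀ λ ¬deep → absurd j rank least (¬Deep⇒S ¬deep)
        where
        absurd : ∀ j → 𝓘 j (restrict α X) → (∀ m → m ℕ.< j → ¬ 𝓘 m (restrict α X)) → ¬ RankBelow j X
        absurd zero    rank least (lift empty)  = empty (𝓘⇒nonempty rank)
        absurd (suc j) rank least (inj₁ rank′)  = least j ℕ.≤-refl rank′
        absurd (suc j) rank least (inj₂ empty)  = empty (𝓘⇒nonempty rank)

    -- A deep set may have larger or infinite rank, so it is thinned to the points used by one
    -- witness. Their depth is recorded too, since it bounds the rank from below.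
    Deep⇒𝓘 : ∀ {j P} → Deep α rank₀ j P → ∃[ X ] X ⊆ P × 𝓘 j (restrict α X) × Deep α rank₀ j X
    Deep⇒𝓘 {P = P} (point x x∈ refl) = only x , (λ y∈ → subst (_∈ P) (sym (∈⁻ y∈)) x∈) ,
      [ id , (λ empty → contradiction (x , ∈⁺ refl) empty) ]′
        -- Level 1 of `RankBelow` is rank 0 or empty, and the singleton is not empty.
        (RankBelow-small {1} (λ y∈ z∈ → trans (∈⁻ y∈) (sym (∈⁻ z∈))) (λ _ ())) ,
      point x (∈⁺ refl) refl
    Deep⇒𝓘 {suc j} {P} (limit d Q Q⊆ inc dQ) =
      X , (λ x∈ → let k , x∈′ = ∈⁻ x∈ in Q⊆ k (Y⊆ k x∈′)) ,
      𝓘-limit d Y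
        (record { parts   = λ k x∈ → ∈⁺ (k , x∈)
                ; cover   = ∈⁻
                ; ordered = increasing⇒ordered {α} d Y-inc })
        (λ k → inj₁ (proj₁ (proj₂ (proj₂ (Deep⇒𝓘 (dQ k))))))
        (let x , x∈ = Deep-nonempty (deep-Y 0) in x , ∈⁺ (0 , x∈)) ,
      limit d Y (λ k x∈ → ∈⁺ (k , x∈)) Y-inc deep-Y
      where
      Y : ℕ → Sub α
      Y k = proj₁ (Deep⇒𝓘 (dQ k))
      Y⊆ : ∀ k → Y k ⊆ Q k
      Y⊆ k = proj₁ (proj₂ (Deep⇒𝓘 (dQ k)))
      Y-inc : Increasing (directed d α) Y
      Y-inc j<k x∈ y∈ = inc j<k (Y⊆ _ x∈) (Y⊆ _ y∈)
      deep-Y : ∀ k → Deep α rank₀ j (Y k)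
      deep-Y k = proj₂ (proj₂ (proj₂ (Deep⇒𝓘 (dQ k))))
      X : Sub α
      X = ⟪ (λ x → ∃[ k ] x ∈ Y k) ⟫

    -- The rank cannot be some `m < j`: the set found keeps depth `j`, hence depth `m + 1`, which
    -- `𝓘⇒¬Deep` excludes in class `m`.
    Deep⇒HasRank : ∀ {j P} → Deep α rank₀ j P → ∃[ X ] X ⊆ P × HasRank (restrict α X) j
    Deep⇒HasRank deep =
      let X , X⊆ , rank , deep-X = Deep⇒𝓘 deep
      in X , X⊆ , rank , λ m m<j rank-m → 𝓘⇒¬Deep rank-m (Deep-antitone m<j (restricted deep-X))
      where
      Deep-antitone : ∀ {β i j P} → i ≤ j → Deep β rank₀ j P → Deep β rank₀ i P
      Deep-antitone = go ∘ ℕ.≤⇒≤′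
        where
        go : ∀ {β i j P} → i ≤′ j → Deep β rank₀ j P → Deep β rank₀ i P
        go ≤′-refl       = id
        go (≤′-step i≤j) = go i≤j ∘ Deep-pred (λ ())
      restricted : ∀ {X j} → Deep α rank₀ j X → Deep (restrict α X) rank₀ j everything
      restricted {X} = Deep-bind (λ x → ⟪ (λ y → proj₁ y ≡ x) ⟫)
        (λ x<y a b → subst₂ (LinearOrder._<_ α) (sym (∈⁻ a)) (sym (∈⁻ b)) x<y)
        (λ x∈ l → point (_ , x∈) (∈⁺ refl) l) _


  -- Splitting depth into a rank and a letter value

  pigeonhole : ∀ (A : ℕ → ℕ → Set) N → (∀ k → ∃[ u ] u ℕ.< N × A u k) → ∃[ u ] u ℕ.< N × Subsequence (A u)
  pigeonhole A zero    f with () ← proj₁ (proj₂ (f 0))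
  pigeonhole A (suc N) f with frequently? (A N)
  ... | inj₁ sub      = N , ℕ.≤-refl , sub
  ... | inj₂ (M , ¬a) =
    let u , u<N , φ , φ-mono , a = pigeonhole (λ u k → A u (M ℕ.+ k)) N (λ k → smaller k (f (M ℕ.+ k)))
    in u , ℕ.m<n⇒m<1+n u<N , (M ℕ.+_) ∘ φ , (λ j<k → ℕ.+-monoʳ-< M (φ-mono j<k)) , a
    where
    smaller : ∀ k → ∃[ u ] u ℕ.< suc N × A u (M ℕ.+ k) → ∃[ u ] u ℕ.< N × A u (M ℕ.+ k)
    smaller k (u , u<1+N , a) = u , ℕ.≤∧≢⇒< (ℕ.≤-pred u<1+N) (λ { refl → ¬a _ (ℕ.m≤m+n M k) a }) , a

  module _ {α : LinearOrder} {lev : ∣ α ∣ → ℕ → Set} where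

    -- Each limit lowers `u` and `v` together, so every point is reached with `v ∸ u` levels left
    -- for its letter.
    ungrade : ∀ {u v P} → u ≤ v → (∀ {x} → x ∈ P → lev x (v ℕ.∸ u)) → Deep α rank₀ u P → Deep α lev v P
    ungrade _         l (point x x∈ refl)      = point x x∈ (l x∈)
    ungrade (s≤s u≤v) l (limit d Q Q⊆ inc dQ) = limit d Q Q⊆ inc (λ k → ungrade u≤v (l ∘ Q⊆ k) (dQ k))

    -- Different branches of a witness may pass through different numbers of limits; at each limit
    -- the pigeonhole principle keeps infinitely many members with a common `u`.
    grade : ∀ {v P} → Deep α lev v P → ∃[ u ] u ℕ.< suc v × Deep α rank₀ u (⟪ (λ x → lev x (v ℕ.∸ u)) ⟫ ∩ P)
    grade (point x x∈ l) = 0 , s≤s z≤n , point x (∈⁺ (∈⁺ l , x∈)) refl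
    grade {suc v} (limit d Q Q⊆ inc dQ) =
      let u , u≤v , φ , φ-mono , deep =
            pigeonhole (λ u k → Deep α rank₀ u (⟪ (λ x → lev x (v ℕ.∸ u)) ⟫ ∩ Q k)) (suc v) (λ k → grade (dQ k))
      in suc u , s≤s u≤v , limit d (λ k → ⟪ (λ x → lev x (v ℕ.∸ u)) ⟫ ∩ Q (φ k))
           (λ k x∈ → let l , x∈Q = ∈⁻ x∈ in ∈⁺ (l , Q⊆ (φ k) x∈Q))
           (λ j<k x∈ y∈ → inc (φ-mono j<k) (proj₂ (∈⁻ x∈)) (proj₂ (∈⁻ y∈)))
           deep

  -- Depth as a ⊛-monoid

  module Evaluation (n : ℕ) where
    open Values n
    open ⊛Algebra (Δ n)

    DeepW : ℕ → (w : Word Value) → Sub (dom w) → Set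
    DeepW v w = Deep (dom w) (λ x → letter w x ⊒_) v

    module _ (A : ℕ → Set) (A-pred : ∀ {v} → A (suc v) → A v) where

      largestBelow : ∀ k → k ≤ suc n → Value
      largestBelow zero    _ = nothing
      largestBelow (suc k) k<n with dec (A k)
      ... | yes _ = just (fromℕ< k<n)
      ... | no _  = largestBelow k (ℕ.<⇒≤ k<n)

      A-≤ : ∀ {u v} → u ≤′ v → A v → A u
      A-≤ ≤′-refl       = id
      A-≤ (≤′-step u≤v) = A-≤ u≤v ∘ A-pred

      largestBelow-⊒⁻ : ∀ k k≤ {v} → largestBelow k k≤ ⊒ v → A v
      largestBelow-⊒⁻ (suc k) k<n ⊒v with dec (A k)
      ... | yes a = A-≤ (ℕ.≤⇒≤′ (subst (_ ≤_) (Fin.toℕ-fromℕ< k<n) ⊒v)) a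
      ... | no _  = largestBelow-⊒⁻ k _ ⊒v

      largestBelow-⊒⁺ : ∀ k k≤ {v} → v ℕ.< k → A v → largestBelow k k≤ ⊒ v
      largestBelow-⊒⁺ (suc k) k<n {v} v<k a with dec (A k)
      ... | yes _ = subst (v ≤_) (sym (Fin.toℕ-fromℕ< k<n)) (ℕ.≤-pred v<k)
      ... | no ¬a = largestBelow-⊒⁺ k _ (ℕ.≤∧≢⇒< (ℕ.≤-pred v<k) (λ { refl → ¬a a })) a

    DeepW-pred : ∀ {w P v} → DeepW (suc v) w P → DeepW v w P
    DeepW-pred {w} = Deep-pred (λ {x} {v} → ⊒-pred {letter w x} {v})

    -- Only levels up to `n` are searched, so greater depth also gives `n`, in accordance with the
    -- cap in τ and τ*.
    eval : Word Value → Value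
    eval w = largestBelow (λ v → DeepW v w everything) (DeepW-pred {w}) (suc n) ℕ.≤-refl

    eval-⊒⁻ : ∀ w {v} → eval w ⊒ v → DeepW v w everything
    eval-⊒⁻ w = largestBelow-⊒⁻ _ (DeepW-pred {w}) (suc n) ℕ.≤-refl

    eval-⊒⁺ : ∀ w {v} → v ≤ n → DeepW v w everything → eval w ⊒ v
    eval-⊒⁺ w v≤n = largestBelow-⊒⁺ _ (DeepW-pred {w}) (suc n) ℕ.≤-refl (s≤s v≤n)

    eval-≅ : ∀ {u w v} → _≅_ (ΔSetoid n) u w → eval u ⊒ v → eval w ⊒ v
    eval-≅ {u} {w} {v} p e = eval-⊒⁺ w (⊒-bound {eval u} e)
      (Deep-map (_≃_.to iso) (_≃_.mono iso) _ (λ {_} {x} _ → subst (_⊒ _) (letters x)) (eval-⊒⁻ u e))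
      where open _≅_ p

    -- `Deep-collapse` along the index of the factor turns depth within one factor into the value of
    -- that factor.
    eval-concat⁻ : ∀ W {v} → eval (concat W) ⊒ v → eval (map eval W) ⊒ v
    eval-concat⁻ W {v} e = eval-⊒⁺ (map eval W) v≤n (Deep-⊆ _ (Deep-collapse proj₁
        (λ { (inter i<j) j<i → LinearOrder.asym (dom W) i<j j<i ; (intra _) i<i → LinearOrder.irrefl (dom W) refl i<i })
        (λ i u≤v d → eval-⊒⁺ (letter W i) (ℕ.≤-trans u≤v v≤n) (Deep-summand d))
        (eval-⊒⁻ (concat W) e)))
      where v≤n = ⊒-bound {eval (concat W)} e

    eval-concat⁺ : ∀ W {v} → eval (map eval W) ⊒ v → eval (concat W) ⊒ v
    eval-concat⁺ W e = eval-⊒⁺ (concat W) (⊒-bound {eval (map eval W)} e)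
      (Deep-bind (fibre proj₁)
        (λ { i<j a b → before i<j (∈⁻ a) (∈⁻ b) })
        (λ {_} {i} _ l → Deep-map (i ,_) intra (λ _ → ∈⁺ refl) (λ _ → id) (eval-⊒⁻ (letter W i) l))
        _ (eval-⊒⁻ (map eval W) e))
      where
      before : ∀ {i j p q} → LinearOrder._<_ (dom W) i j → proj₁ p ≡ i → proj₁ q ≡ j →
               LinearOrder._<_ (dom (concat W)) p q
      before i<j refl refl = inter i<j

    evalMonoid : ⊛Monoid (ΔSetoid n)
    evalMonoid = record
      { π           = eval
      ; π-cong      = λ {u} {w} p → ⊒-ext (eval-≅ p) (eval-≅ (Setoid.sym (wordSetoid (ΔSetoid n)) {u} {w} p))
      ; π-singleton = λ x → ⊒-ext
          (λ e → let i , _ , l = Deep-finite (allFin 1) (λ {i} _ → ∈-allFin i) (eval-⊒⁻ (singleton x) e) in single i l)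
          (λ x⊒ → eval-⊒⁺ (singleton x) (⊒-bound {x} x⊒) (point zero _ x⊒))
      ; π-concat    = λ W → ⊒-ext (eval-concat⁻ W) (eval-concat⁺ W)
      }
      where
      single : ∀ {x v} i → letter (singleton x) i ⊒ v → x ⊒ v
      single zero l = l

    eval-two : ∀ x y → x · y ≡ eval (two x y)
    eval-two x y = ⊒-ext
      (λ xy⊒ → eval-⊒⁺ (two x y) (⊒-bound {x · y} xy⊒)
        ([ point zero _ , point (suc zero) _ ]′ (·-⊒⁻ x y xy⊒)))
      (λ e → let i , _ , l = Deep-finite (allFin 2) (λ {i} _ → ∈-allFin i) (eval-⊒⁻ (two x y) e) in ·-⊒⁺ x y (pick i l))
      where
      pick : ∀ {v} i → letter (two x y) i ⊒ v → x ⊒ v ⊎ y ⊒ v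
      pick zero       = inj₁
      pick (suc zero) = inj₂

    ω-locallyFinite : ∀ d (x z : ℕ) → ∃[ ys ] ∀ y → LinearOrder._<_ (ω d) x y → LinearOrder._<_ (ω d) y z → y ∈ₗ ys
    ω-locallyFinite up   x z = upTo z , λ _ _ y<z → ∈-upTo⁺ y<z
    ω-locallyFinite down x z = upTo x , λ _ y<x _ → ∈-upTo⁺ y<x

    -- The sequence of singletons adds one level to the letter; local finiteness of `ω d` prevents a
    -- second.
    eval-ω : ∀ d x → bump d x ≡ eval (ωword d (const x))
    eval-ω d x = ⊒-ext (λ {v} b → eval-⊒⁺ (ωword d (const x)) (⊒-bound {bump d x} b) (deep v b)) shallow
      where
      deep : ∀ v → bump d x ⊒ v → DeepW v (ωword d (const x)) everything
      deep zero    b = point 0 _ (bump-⊒0 d x b)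
      deep (suc v) b = limit d only (λ _ _ → _)
        (λ j<k a b → subst₂ (LinearOrder._<_ (directed d (ω d))) (sym (∈⁻ a)) (sym (∈⁻ b)) (<⇒<-directed-ω {d} j<k))
        (λ k → point k (∈⁺ refl) (bump-⊒⁻ d x b))
      shallow : ∀ {v} → eval (ωword d (const x)) ⊒ v → bump d x ⊒ v
      shallow {zero} e = bump-⊒0⁺ d x (witness (eval-⊒⁻ (ωword d (const x)) e))
        where
        witness : DeepW 0 (ωword d (const x)) everything → x ⊒ 0
        witness (point _ _ x⊒0) = x⊒0
      shallow {suc v} e =
        let _ , _ , l = Deep-locallyFinite (ω-locallyFinite d) (eval-⊒⁻ (ωword d (const x)) e)
        in bump-⊒⁺ d x ([ ⊒-pred {x} , id ]′ l) (⊒-bound {eval (ωword d (const x))} e)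

    module _ {E} (s : ℚ → Value) (shuffle : IsPerfectShuffle (ΔSetoid n) E s) where
      open IsPerfectShuffle shuffle

      between : ℚ → ℚ → ℚ → Bool
      between p q = ⟪ (λ x → p ℚ.< x × x ℚ.< q) ⟫

      -- Every open interval contains an increasing sequence of smaller open intervals, so any level
      -- is reached; at level 0 density of the shuffle supplies a letter other than the identity.
      shuffle-deep : ∀ {i} → just i ∈ₗ toList E → ∀ v {p q} → p ℚ.< q → DeepW v (ℚ-word s) (between p q)
      shuffle-deep i∈ zero {p} {q} p<q =
        let r  , p<r  , r<q = ℚ.<-dense p<q
            r′ , r<r′ , r′<q = ℚ.<-dense r<q
            x , x∈ , eq = dense (between p q)
              (λ a<b b<c a∈ c∈ → ∈⁺ (ℚ.<-trans (proj₁ (∈⁻ a∈)) a<b , ℚ.<-trans b<c (proj₂ (∈⁻ c∈))))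
              (r , r′ , ℚ.<⇒≢ r<r′ , ∈⁺ (p<r , r<q) , ∈⁺ (ℚ.<-trans p<r r<r′ , r′<q)) _ i∈
        in point x x∈ (subst (_⊒ 0) (sym eq) z≤n)
      shuffle-deep i∈ (suc v) {p} {q} p<q = limit up (λ k → between (rung k) (rung (suc k)))
        (λ k x∈ → ∈⁺ (ℚ.≤-<-trans (p≤ k) (proj₁ (∈⁻ x∈)) , ℚ.<-trans (proj₂ (∈⁻ x∈)) (rung<q (suc k))))
        (λ j<k x∈ y∈ → ℚ.<-trans (proj₂ (∈⁻ x∈)) (ℚ.≤-<-trans (rung-mono (ℕ.≤⇒≤′ j<k)) (proj₁ (∈⁻ y∈))))
        (λ k → shuffle-deep i∈ v (rung-step k))
        where
        ladder : ℕ → Σ[ r ∈ ℚ ] r ℚ.< q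
        ladder zero    = p , p<q
        ladder (suc k) = let m , _ , m<q = ℚ.<-dense (proj₂ (ladder k)) in m , m<q
        rung : ℕ → ℚ
        rung k = proj₁ (ladder k)
        rung<q : ∀ k → rung k ℚ.< q
        rung<q k = proj₂ (ladder k)
        rung-step : ∀ k → rung k ℚ.< rung (suc k)
        rung-step k = proj₁ (proj₂ (ℚ.<-dense (proj₂ (ladder k))))
        rung-mono : ∀ {j k} → j ≤′ k → rung j ℚ.≤ rung k
        rung-mono ≤′-refl       = ℚ.≤-refl
        rung-mono (≤′-step {n = k} j≤k) = ℚ.≤-trans (rung-mono j≤k) (ℚ.<⇒≤ (rung-step k))
        p≤ : ∀ k → p ℚ.≤ rung k
        p≤ k = rung-mono (ℕ.≤⇒≤′ (z≤n {k}))

      eval-shuffle : E ^κ ≡ eval (ℚ-word s)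
      eval-shuffle = cases _ (any⁻ is-just (toList E)) (λ ¬any {q} → all-id ¬any q)
        where
        cases : ∀ b → (T b → Any (T ∘ is-just) (toList E)) → (¬ T b → ∀ {q v} → ¬ s q ⊒ v) →
                (if b then just (fromℕ n) else nothing) ≡ eval (ℚ-word s)
        cases true  any _ = ⊒-ext
          (λ v≤n → let x , x∈ , x-just = find (any _) in
            eval-⊒⁺ (ℚ-word s) (subst (_ ≤_) (Fin.toℕ-fromℕ n) v≤n)
              (Deep-⊆ _ (somewhere x x-just x∈)))
          (λ e → subst (_ ≤_) (sym (Fin.toℕ-fromℕ n)) (⊒-bound {eval (ℚ-word s)} e))
          where
          somewhere : ∀ {v} x → T (is-just x) → x ∈ₗ toList E → DeepW v (ℚ-word s) (between ℚ.0ℚ ℚ.1ℚ)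
          somewhere (just _) _ x∈ = shuffle-deep x∈ _ (ℚ.positive⁻¹ ℚ.1ℚ)
        cases false _ none = ⊒-ext (λ ()) (λ e → ⊥-elim (no-deep none (eval-⊒⁻ (ℚ-word s) e)))
          where
          no-deep : (¬ ⊥ → ∀ {q v} → ¬ s q ⊒ v) → ∀ {v P} → ¬ DeepW v (ℚ-word s) P
          no-deep none (point _ _ l)      = none id l
          no-deep none (limit _ _ _ _ dQ) = no-deep none (dQ 0)
        all-id : ¬ T (any is-just (toList E)) → ∀ q {v} → ¬ s q ⊒ v
        all-id ¬any q with s q | letters-in-E q
        ... | just i | sq∈ = λ _ → ¬any (any⁺ is-just (Any.map (λ { refl → tt }) sq∈))

    evalMonoid-induces : Induces evalMonoid (Δ n)
    evalMonoid-induces = record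
      { 𝟙-induced  = ⊒-ext (λ ()) λ e → ⊥-elim (Fin.¬Fin0 (proj₁ (Deep-nonempty (eval-⊒⁻ ε e))))
      ; ·-induced  = eval-two
      ; τ-induced  = eval-ω up
      ; τ*-induced = eval-ω down
      ; κ-induced  = λ E s → eval-shuffle {E} s
      }

  -- Uniqueness of the ⊛-monoid inducing Δₙ

  module Uniqueness (n : ℕ) (D : ⊛Monoid (ΔSetoid n)) (induces : Induces D (Δ n)) where
    open Values n
    open Evaluation n using (DeepW)
    open ⊛Algebra (Δ n)
    open ⊛Monoid D
    open Induces induces

    mask : Bool → Value → Value
    mask b x = if b then x else nothing

    -- Erasing letters, unlike restricting the domain, relates the values of all subsets of one order.
    erase : (w : Word Value) → Sub (dom w) → Word Value
    erase w P = record { dom = dom w ; countable = countable w ; letter = λ x → mask (P x) (letter w x) }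

    value : (w : Word Value) → Sub (dom w) → Value
    value w P = π (erase w P)

    π-pointwise : ∀ {α c c′ f g} → (∀ x → f x ≡ g x) →
                  π (record { dom = α ; countable = c ; letter = f }) ≡ π (record { dom = α ; countable = c′ ; letter = g })
    π-pointwise eq = π-cong (record { iso = ≃-refl ; letters = eq })

    -- A word of identities is the word of values of empty words, whose concatenation is empty.
    π-nothing : ∀ {w} → (∀ x → letter w x ≡ nothing) → π w ≡ nothing
    π-nothing {w} eq = begin
      π w            ≡⟨ π-pointwise (λ x → trans (eq x) 𝟙-induced) ⟩
      π (map π u)    ≡⟨ π-concat u ⟨
      π (concat u)   ≡⟨ π-cong {concat u} {ε} (record
        { iso     = mk≃ (dom (concat u)) (finₒ 0) proj₂ (λ { {_ , ()} }) (λ ())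
        ; letters = λ { (_ , ()) } }) ⟩
      π ε            ≡⟨ 𝟙-induced ⟨
      nothing        ∎
      where
      open ≡-Reasoning
      u : Word (Word Value)
      u = map (const ε) w

    optional : Bool → Value → Word Value
    optional b x = if b then singleton x else ε

    -- Replace each erased position by `ε` and each kept one by a one-letter word: the concatenation
    -- is the restricted word, and associativity of `π` does the rest.
    value-restrict : ∀ w P → value w P ≡ π (restrictW w P)
    value-restrict w P = begin
      π (erase w P)        ≡⟨ π-pointwise (λ x → optional-π (P x) (letter w x)) ⟩
      π (map π u)          ≡⟨ π-concat u ⟨
      π (concat u)         ≡⟨ π-cong (record
        { iso     = mk≃ (dom (concat u)) (restrict (dom w) P)
                        (λ (x , i) → x , here∈ (P x) i)
                        (λ { (inter x<y) → x<y ; (intra {x} i<j) → ⊥-elim (trivial (P x) i<j) })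
                        (λ (x , x∈) → (x , first (P x) x∈) , cong (x ,_) (T-irrelevant _ _))
        ; letters = λ (x , i) → optional-letter (P x) i }) ⟩
      π (restrictW w P)    ∎
      where
      open ≡-Reasoning
      u : Word (Word Value)
      u = record { dom = dom w ; countable = countable w ; letter = λ x → optional (P x) (letter w x) }
      optional-π : ∀ b x → mask b x ≡ π (optional b x)
      optional-π true  x = sym (π-singleton x)
      optional-π false x = 𝟙-induced
      here∈ : ∀ b {x} → ∣ dom (optional b x) ∣ → T b
      here∈ true _ = tt
      first : ∀ b {x} → T b → ∣ dom (optional b x) ∣
      first true _ = zero
      trivial : ∀ b {x} {i j : ∣ dom (optional b x) ∣} → ¬ LinearOrder._<_ (dom (optional b x)) i j
      trivial true {i = zero} {zero} ()
      optional-letter : ∀ b {x} (i : ∣ dom (optional b x) ∣) → letter (optional b x) i ≡ x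
      optional-letter true zero = refl

    value-partition : ∀ {w β R Q} → Partition (dom w) β R Q → (c : Countable ∣ β ∣) →
                      value w R ≡ π (record { dom = β ; countable = c ; letter = λ i → value w (Q i) })
    value-partition {w} {β} {R} {Q} p c = begin
      value w R          ≡⟨ value-restrict w R ⟩
      π (restrictW w R)  ≡⟨ π-cong {concat u} {restrictW w R} (record { iso = sum-≃-restrict p ; letters = λ _ → refl }) ⟨
      π (concat u)       ≡⟨ π-concat u ⟩
      π (map π u)        ≡⟨ π-pointwise (λ i → sym (value-restrict w (Q i))) ⟩
      π (record { dom = β ; countable = c ; letter = λ i → value w (Q i) }) ∎
      where
      open ≡-Reasoning
      u : Word (Word Value)
      u = record { dom = β ; countable = c ; letter = λ i → restrictW w (Q i) }

    value-binary : ∀ {w R} Q → Partition (dom w) (finₒ 2) R Q → value w R ≡ value w (Q zero) · value w (Q (suc zero))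
    value-binary {w} Q p = trans (value-partition {w} p Fin-countable)
      (trans (π-pointwise (λ { zero → refl ; (suc zero) → refl })) (sym (·-induced _ _)))

    value-only : ∀ w {P} x → x ∈ P → (∀ {y} → y ∈ P → y ≡ x) → value w P ≡ letter w x
    value-only w {P} x x∈ unique = begin
      value w P                ≡⟨ value-restrict w P ⟩
      π (restrictW w P)        ≡⟨ π-cong {singleton (letter w x)} {restrictW w P} (record
        { iso     = mk≃ (finₒ 1) (restrict (dom w) P) (λ _ → x , x∈) (λ { {zero} {zero} () })
                        (λ (y , y∈) → zero , equal y∈ (unique y∈))
        ; letters = λ { zero → refl } }) ⟨
      π (singleton (letter w x)) ≡⟨ π-singleton _ ⟩
      letter w x               ∎
      where
      open ≡-Reasoning
      equal : ∀ {y} (y∈ : y ∈ P) → y ≡ x → (x , x∈) ≡ (y , y∈)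
      equal y∈ refl = cong (x ,_) (T-irrelevant _ _)

    value-empty : ∀ w {P} → (∀ {x} → x ∈ P → letter w x ≡ nothing) → value w P ≡ nothing
    value-empty w {P} empty = π-nothing (λ x → masked (P x) empty)
      where
      masked : ∀ b {x} → (T b → letter w x ≡ nothing) → mask b (letter w x) ≡ nothing
      masked true  eq = eq tt
      masked false _  = refl

    Below : (w : Word Value) → ℕ → Sub (dom w) → Set
    Below w v P = v ≤ n → ¬ value w P ⊒ v

    Below-small : ∀ w {v P} → (∀ {x y} → x ∈ P → y ∈ P → x ≡ y) → (∀ {x} → x ∈ P → ¬ letter w x ⊒ v) → Below w v P
    Below-small w {v} {P} single small _ ⊒v with dec (∃[ x ] x ∈ P)
    ... | yes (x , x∈) = small x∈ (subst (_⊒ v) (value-only w x x∈ (λ y∈ → single y∈ x∈)) ⊒v)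
    ... | no none      = subst (_⊒ v) (value-empty w (λ x∈ → ⊥-elim (none (_ , x∈)))) ⊒v

    Below-zero : ∀ w {P} → (∀ {x} → x ∈ P → ¬ letter w x ⊒ 0) → Below w 0 P
    Below-zero w {P} small _ ⊒0 = subst (_⊒ 0) (value-empty w (⋣⇒nothing ∘ small)) ⊒0

    Below-add : ∀ w {v R} Q → Partition (dom w) (finₒ 2) R Q → (∀ i → Below w v (Q i)) → Below w v R
    Below-add w {v} Q p below v≤n ⊒v =
      [ below zero v≤n , below (suc zero) v≤n ]′ (·-⊒⁻ (value w (Q zero)) _ (subst (_⊒ v) (value-binary {w} Q p) ⊒v))

    Below-∪ : ∀ d w {v P Q R} → (∀ {x} → x ∈ R → x ∈ P ⊎ x ∈ Q) → P ⊆ R → Q ⊆ R → Before (directed d (dom w)) P Q →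
              Below w v P → Below w v Q → Below w v R
    Below-∪ up   w cov P⊆ Q⊆ P<Q bP bQ = Below-add w (binary _ _)
      (binaryPartition cov P⊆ Q⊆ P<Q) λ { zero → bP ; (suc zero) → bQ }
    Below-∪ down w cov P⊆ Q⊆ P<Q bP bQ = Below-add w (binary _ _)
      (binaryPartition (swap ∘ cov) Q⊆ P⊆ (λ a b → P<Q b a)) λ { zero → bQ ; (suc zero) → bP }

    value-⊒-part : ∀ w {v R P Q} → (∀ {x} → x ∈ R → x ∈ P ⊎ x ∈ Q) → P ⊆ R → Q ⊆ R → Before (dom w) P Q →
                   value w P ⊒ v ⊎ value w Q ⊒ v → value w R ⊒ v
    value-⊒-part w {v} cov P⊆ Q⊆ P<Q ⊒v =
      subst (_⊒ v) (sym (value-binary {w} _ (binaryPartition cov P⊆ Q⊆ P<Q))) (·-⊒⁺ (value w _) _ ⊒v)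

    Convex : (α : LinearOrder) → Sub α → Sub α → Set
    Convex α Q R = ∀ {x y z} → x ∈ Q → z ∈ Q → y ∈ R → LinearOrder._<_ α x y → LinearOrder._<_ α y z → y ∈ Q

    -- Convexity cuts `R` into the points before `Q`, `Q` itself, and the points after it; the
    -- product in Δₙ is a maximum.
    value-convex : ∀ w {v Q R} → Q ⊆ R → Convex (dom w) Q R → value w Q ⊒ v → value w R ⊒ v
    value-convex w {v} {Q} {R} Q⊆R convex ⊒v =
      value-⊒-part w {P = R ∖ U} {Q = U} (λ {x} x∈ → either x∈ (x ∈? U)) (proj₁ ∘ ∈⁻) (proj₁ ∘ ∈⁻) below
        (inj₂ (value-⊒-part w {P = Q} {Q = U ∖ Q} (λ {x} x∈ → swap (either x∈ (x ∈? Q)))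
          (λ x∈ → ∈⁺ (Q⊆R x∈ , _ , x∈ , irrefl refl)) (proj₁ ∘ ∈⁻) above (inj₁ ⊒v)))
      where
      open LinearOrder (dom w)
      _∖_ : Sub (dom w) → Sub (dom w) → Sub (dom w)
      A ∖ B = ⟪ (λ x → x ∈ A × ¬ x ∈ B) ⟫
      _∈?_ : ∀ x (A : Sub (dom w)) → Dec (x ∈ A)
      x ∈? A = dec (x ∈ A)
      either : ∀ {A B : Sub (dom w)} {x} → x ∈ A → Dec (x ∈ B) → x ∈ A ∖ B ⊎ x ∈ B
      either x∈ (yes b) = inj₂ b
      either x∈ (no ¬b) = inj₁ (∈⁺ (x∈ , ¬b))
      U : Sub (dom w)
      U = ⟪ (λ y → y ∈ R × ∃[ q ] q ∈ Q × ¬ y < q) ⟫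
      below : Before (dom w) (R ∖ U) U
      below {x} {y} x∈ y∈ with compare x y
      ... | tri< x<y _ _ = x<y
      ... | tri≈ _ refl _ = contradiction y∈ (proj₂ (∈⁻ x∈))
      ... | tri> _ _ y<x =
        let x∈R , x∉U = ∈⁻ x∈
            _ , q , q∈ , y≮q = ∈⁻ y∈
        in contradiction (∈⁺ (x∈R , q , q∈ , λ x<q → y≮q (<-trans y<x x<q))) x∉U
      above : Before (dom w) Q (U ∖ Q)
      above {x} {y} x∈ y∈ with compare x y | ∈⁻ y∈
      ... | tri< x<y _ _ | _ = x<y
      ... | tri≈ _ refl _ | _ , y∉Q = contradiction x∈ y∉Q
      ... | tri> _ _ y<x | y∈U , y∉Q with ∈⁻ y∈U
      ... | y∈R , q , q∈ , y≮q with compare q y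
      ... | tri< q<y _ _ = contradiction (convex q∈ x∈ y∈R q<y y<x) y∉Q
      ... | tri≈ _ refl _ = contradiction q∈ y∉Q
      ... | tri> _ _ y<q = contradiction y<q y≮q

    value-letter : ∀ w {v P x} → x ∈ P → letter w x ⊒ v → value w P ⊒ v
    value-letter w {v} {P} {x} x∈ l = value-convex w {Q = only x} (λ y∈ → subst (_∈ P) (sym (∈⁻ y∈)) x∈)
      (λ a b _ x<y y<z → ⊥-elim (asym x<y (subst₂ _<_ refl (trans (∈⁻ b) (sym (∈⁻ a))) y<z)))
      (subst (_⊒ v) (sym (value-only w x (∈⁺ refl) ∈⁻)) l)
      where open LinearOrder (dom w)

    π-ω : ∀ d x → π (ωword d (const x)) ≡ bump d x
    π-ω up   x = sym (τ-induced x)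
    π-ω down x = sym (τ*-induced x)

    -- A single letter of value at least `v + 1` suffices. If there is none, all letters are exactly
    -- `v`, the word is constant, and τ or τ* gives its value.
    ω-⊒⁺ : ∀ d {a v} → (∀ k → a k ⊒ v) → suc v ≤ n → π (ωword d a) ⊒ suc v
    ω-⊒⁺ d {a} {v} a⊒v v<n with dec (∃[ k ] a k ⊒ suc v)
    ... | yes (k , l) = value-letter (ωword d a) {P = everything} {k} _ l
    ... | no none = subst (_⊒ suc v) (sym (trans (π-pointwise {c′ = ℕ-countable} (λ k → exact k)) (π-ω d (a 0))))
      (bump-⊒⁺ d (a 0) (a⊒v 0) v<n)
      where
      exact : ∀ k → a k ≡ a 0
      exact k = ⊒-exact (a⊒v k) (λ l → none (k , l)) (a⊒v 0) (λ l → none (0 , l))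

    ω-below : ∀ d a {v P N} → (∀ {k} → k ∈ P → k ℕ.< N) → (∀ {k} → k ∈ P → ¬ a k ⊒ v) → Below (ωword d a) v P
    ω-below d a {N = zero}  bound small = Below-small (ωword d a) (λ x∈ → case bound x∈ of λ ()) small
    ω-below d a {P = P} {suc N} bound small = Below-∪ d (ωword d a)
      {P = ⟪ (λ k → k ∈ P × k ℕ.< N) ⟫} {Q = ⟪ (λ k → k ∈ P × k ≡ N) ⟫}
      (λ k∈ → [ (λ k<N → inj₁ (∈⁺ (k∈ , k<N))) , (λ k≡N → inj₂ (∈⁺ (k∈ , k≡N))) ]′ (ℕ.m≤n⇒m<n∨m≡n (ℕ.≤-pred (bound k∈))))
      (proj₁ ∘ ∈⁻) (proj₁ ∘ ∈⁻)
      (λ j∈ k∈ → <⇒<-directed-ω {d} (subst (_ ℕ.<_) (sym (proj₂ (∈⁻ k∈))) (proj₂ (∈⁻ j∈))))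
      (ω-below d a {N = N} (proj₂ ∘ ∈⁻) (small ∘ proj₁ ∘ ∈⁻))
      (Below-small (ωword d a) (λ j∈ k∈ → trans (proj₂ (∈⁻ j∈)) (sym (proj₂ (∈⁻ k∈)))) (small ∘ proj₁ ∘ ∈⁻))

    -- The axioms determine ω-words only when they are constant. If value `v` recurs forever,
    -- regrouping makes the word constant; if not, it is a finite part without large letters and a
    -- tail covered by the induction hypothesis.
    ω-⊒⁻ : ∀ d v {a} → (∀ k → ¬ a k ⊒ v) → suc v ≤ n → ¬ π (ωword d a) ⊒ suc v
    ω-⊒⁻ d zero small _ ⊒1 with () ← subst (_⊒ 1) (π-nothing (λ k → ⋣⇒nothing (small k))) ⊒1
    ω-⊒⁻ d (suc v) {a} small v<n ⊒v+2 with frequently? (λ k → a k ⊒ v)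
    -- Letters of value v occur infinitely often: regroup into blocks of value exactly v.
    ... | inj₁ (φ , φ-mono , large) =
      block-small 0 (bump-⊒⁻ d (value W (block 0)) ⊒bump)
      where
      W : Word Value
      W = ωword d a
      -- The cuts come just after the positions `φ k`, so that block `k` contains the large letter
      -- at `φ k`.
      ψ : ℕ → ℕ
      ψ zero    = 0
      ψ (suc k) = suc (φ k)
      ψ≤φ : ∀ k → ψ k ≤ φ k
      ψ≤φ zero    = z≤n
      ψ≤φ (suc k) = φ-mono ℕ.≤-refl
      ψ-mono : StrictlyMono ψ
      ψ-mono = strictlyMono ψ (λ k → s≤s (ψ≤φ k))
      block : ℕ → Sub (ω d)
      block k = ⟪ (λ j → ψ k ≤ j × j ℕ.< ψ (suc k)) ⟫
      find-block : ∀ m {j} → j ℕ.< ψ m → ∃[ k ] j ∈ block k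
      find-block (suc m) {j} j< with j ℕ.<? ψ m
      ... | yes j<′ = find-block m j<′
      ... | no  j≮  = m , ∈⁺ (ℕ.≮⇒≥ j≮ , j<)
      ψ-unbounded : ∀ j → j ≤ ψ j
      ψ-unbounded zero    = z≤n
      ψ-unbounded (suc j) = ℕ.≤-<-trans (ψ-unbounded j) (ψ-mono ℕ.≤-refl)
      partition : Partition (dom W) (ω d) everything block
      partition = record
        { parts   = λ _ _ → tt
        ; cover   = λ {j} _ → find-block (suc j) (ψ-unbounded (suc j))
        ; ordered = increasing⇒ordered {dom W} d λ j<k x∈ y∈ → <⇒<-directed-ω {d}
            (ℕ.<-≤-trans (proj₂ (∈⁻ x∈)) (ℕ.≤-trans (StrictlyMono⇒≤ ψ-mono j<k) (proj₁ (∈⁻ y∈))))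
        }
      block-small : ∀ k → ¬ value W (block k) ⊒ suc v
      block-small k = ω-below d a (proj₂ ∘ ∈⁻) (λ {j} _ → small j) (ℕ.<⇒≤ v<n)
      block-large : ∀ k → value W (block k) ⊒ v
      block-large k = value-letter W (∈⁺ (ψ≤φ k , ℕ.≤-refl)) (large k)
      ⊒bump : bump d (value W (block 0)) ⊒ suc (suc v)
      ⊒bump = subst (_⊒ suc (suc v))
        (trans (value-partition {W} partition ℕ-countable)
          (trans (π-pointwise (λ k → ⊒-exact (block-large k) (block-small k) (block-large 0) (block-small 0))) (π-ω d _)))
        ⊒v+2
    ... | inj₂ (N , small′) =
      Below-∪ d W {P = ⟪ (ℕ._< N) ⟫} {Q = ⟪ (N ≤_) ⟫}
        (λ {k} _ → case k ℕ.<? N of λ { (yes k<N) → inj₁ (∈⁺ k<N) ; (no k≮N) → inj₂ (∈⁺ (ℕ.≮⇒≥ k≮N)) })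
        _ _ (λ j∈ k∈ → <⇒<-directed-ω {d} (ℕ.<-≤-trans (∈⁻ j∈) (∈⁻ k∈)))
        (ω-below d a ∈⁻ (λ {k} _ → small k ∘ ⊒-pred {a k}))
        (λ _ tail⊒ → ω-⊒⁻ d v
          (λ k → Below-small W {P = only (N ℕ.+ k)} (λ x∈ y∈ → trans (∈⁻ x∈) (sym (∈⁻ y∈)))
            (λ x∈ → subst (λ j → ¬ a j ⊒ v) (sym (∈⁻ x∈)) (small′ (N ℕ.+ k) (ℕ.m≤m+n N k)))
            (ℕ.≤-trans (ℕ.n≤1+n v) (ℕ.<⇒≤ v<n)))
          (ℕ.<⇒≤ v<n)
          (⊒-pred {π (ωword d (λ k → value W (only (N ℕ.+ k))))}
            (subst (_⊒ suc (suc v)) (value-partition {W} tail ℕ-countable) tail⊒)))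
        v<n ⊒v+2
      where
      W : Word Value
      W = ωword d a
      tail : Partition (dom W) (ω d) ⟪ (N ≤_) ⟫ (λ k → only (N ℕ.+ k))
      tail = record
        { parts   = λ k x∈ → ∈⁺ (subst (N ≤_) (sym (∈⁻ x∈)) (ℕ.m≤m+n N k))
        ; cover   = λ {x} x∈ → x ℕ.∸ N , ∈⁺ (sym (ℕ.m+[n∸m]≡n (∈⁻ x∈)))
        ; ordered = increasing⇒ordered {dom W} d λ j<k x∈ y∈ → <⇒<-directed-ω {d}
            (subst₂ ℕ._<_ (sym (∈⁻ x∈)) (sym (∈⁻ y∈)) (ℕ.+-monoʳ-< N j<k))
        }

    Below-ω : ∀ w {v R} d Q → Partition (dom w) (ω d) R Q → (∀ k → Below w v (Q k)) → Below w (suc v) R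
    Below-ω w {v} d Q p below v<n ⊒v+1 = ω-⊒⁻ d v (λ k → below k (ℕ.<⇒≤ v<n)) v<n
      (subst (_⊒ suc v) (value-partition {w} p ℕ-countable) ⊒v+1)

    Convex-directed : ∀ {α Q R} d → Convex (directed d α) Q R → Convex α Q R
    Convex-directed up   c               = c
    Convex-directed down c x∈ z∈ y∈ x<y y<z = c z∈ x∈ y∈ y<z x<y

    -- The superset `P` is arbitrary because the induction hypothesis is needed for blocks that
    -- enlarge the sets of the sequence.
    Deep⇒⊒ : ∀ w {v Q} → DeepW v w Q → ∀ {P} → Q ⊆ P → v ≤ n → value w P ⊒ v
    Deep⇒⊒ w (point x x∈ l) Q⊆P _ = value-letter w (Q⊆P x∈) l
    Deep⇒⊒ w {suc v} (limit d Q Q⊆ inc dQ) {P} Q⊆P v<n =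
      value-convex w (proj₁ ∘ ∈⁻ ∘ proj₁ ∘ ∈⁻) (Convex-directed {dom w} d convex)
        (subst (_⊒ suc v) (sym (value-partition {w} partition ℕ-countable))
          (ω-⊒⁺ d (λ k → Deep⇒⊒ w (dQ k) (Q⊆block k) (ℕ.<⇒≤ v<n)) v<n))
      where
      open LinearOrder (directed d (dom w))
      -- The differences of these final segments of P are convex in P, unlike the sets Q k.
      U : ℕ → Sub (dom w)
      U k = ⟪ (λ y → y ∈ P × ∃[ q ] q ∈ Q k × ¬ y < q) ⟫
      U-up : ∀ {k x y} → x ∈ U k → y ∈ P → x < y → y ∈ U k
      U-up x∈ y∈P x<y = let _ , q , q∈ , x≮q = ∈⁻ x∈ in ∈⁺ (y∈P , q , q∈ , λ y<q → x≮q (<-trans x<y y<q))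
      U-down : ∀ {j k} → j ℕ.< k → U k ⊆ U j
      U-down j<k y∈ =
        let y∈P , q , q∈ , y≮q = ∈⁻ y∈
            q′ , q′∈ = Deep-nonempty (dQ _)
        in ∈⁺ (y∈P , q′ , q′∈ , λ y<q′ → y≮q (<-trans y<q′ (inc j<k q′∈ q∈)))
      block : ℕ → Sub (dom w)
      block k = ⟪ (λ y → y ∈ U k × ¬ y ∈ U (suc k)) ⟫
      -- Points of `P` in every `U k` lie beyond the whole sequence; without them the blocks cover
      -- `R`.
      R : Sub (dom w)
      R = ⟪ (λ y → y ∈ U 0 × ∃[ k ] ¬ y ∈ U k) ⟫
      Q⊆block : ∀ k → Q k ⊆ block k
      Q⊆block k x∈ = ∈⁺ (∈⁺ (Q⊆P (Q⊆ k x∈) , _ , x∈ , irrefl refl) ,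
        λ (x∈U : _ ∈ U (suc k)) → let _ , q , q∈ , x≮q = ∈⁻ x∈U in x≮q (inc ℕ.≤-refl x∈ q∈))
      find-block : ∀ k {y} → y ∈ U 0 → ¬ y ∈ U k → ∃[ j ] y ∈ block j
      find-block zero    y∈ y∉ = contradiction y∈ y∉
      find-block (suc k) {y} y∈ y∉ with dec (y ∈ U k)
      ... | yes y∈U = k , ∈⁺ (y∈U , y∉)
      ... | no  y∉U = find-block k y∈ y∉U
      U⊆U0 : ∀ k → U k ⊆ U 0
      U⊆U0 zero    = id
      U⊆U0 (suc k) = U-down (s≤s z≤n)
      U-≤ : ∀ {j k} → j ℕ.< k → U k ⊆ U (suc j)
      U-≤ j<k = [ (λ lt → U-down lt) , (λ { refl → id }) ]′ (ℕ.m≤n⇒m<n∨m≡n j<k)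
      block-inc : Increasing (directed d (dom w)) block
      block-inc {j} {k} j<k {x} {y} x∈ y∈ with compare x y | ∈⁻ x∈ | ∈⁻ y∈
      ... | tri< x<y _ _  | _         | _       = x<y
      ... | tri≈ _ refl _ | _ , x∉    | y∈U , _ = contradiction (U-≤ j<k y∈U) x∉
      ... | tri> _ _ y<x  | x∈U , x∉  | y∈U , _ = contradiction (U-up {suc j} (U-≤ j<k y∈U) (proj₁ (∈⁻ x∈U)) y<x) x∉
      partition : Partition (dom w) (ω d) R block
      partition = record
        { parts   = λ k y∈ → let y∈U , y∉U = ∈⁻ y∈ in ∈⁺ (U⊆U0 k y∈U , suc k , y∉U)
        ; cover   = λ y∈ → let y∈U , k , y∉U = ∈⁻ y∈ in find-block k y∈U y∉U
        ; ordered = increasing⇒ordered {dom w} d block-inc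
        }
      convex : Convex (directed d (dom w)) R P
      convex x∈ z∈ y∈ x<y y<z =
        let x∈U , _ = ∈⁻ x∈
            z∈U , k , z∉U = ∈⁻ z∈
        in ∈⁺ (U-up x∈U y∈ x<y , k , λ y∈U → z∉U (U-up y∈U (proj₁ (∈⁻ z∈U)) y<z))

    π-⊒⁺ : ∀ w {v} → v ≤ n → DeepW v w everything → π w ⊒ v
    π-⊒⁺ w v≤n deep = Deep⇒⊒ w deep id v≤n

    -- By contraposition: every construction step in `Structure` keeps the value `Below` its level.
    π-⊒⁻ : ∀ w {v} → π w ⊒ v → DeepW v w everything
    π-⊒⁻ w {v} ⊒v = by-contradiction₀ λ ¬deep → lower (¬Deep⇒S ¬deep) (⊒-bound {π w} ⊒v) ⊒v
      where
      open Structure (dom w) (countable w) (λ x → letter w x ⊒_) (λ v P → Lift 1ℓ (Below w v P))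
        (λ small → lift (Below-zero w small))
        (λ single small → lift (Below-small w single small))
        (λ Q p below → lift (Below-add w Q p (λ i → lower (below i))))
        (λ d Q p below → lift (Below-ω w d Q p (λ k → lower (below k))))

  -- One-variable sentences

  module Logic (n : ℕ) {Sig : Set} {m : ℕ} (enum : Sig ↔ Fin m) where
    open Values n
    open Evaluation n
    private module enum = Inverse enum

    falsum : ∀ {Γ} → Formula Sig n 1 Γ
    falsum {Γ} = ex zero (less zero zero z∈ z∈)
      where z∈ = p⊆p∪q Γ (x∈⁅x⁆ zero)

    ⋁ : ∀ {k Γ} → (Fin k → Formula Sig n 1 Γ) → Formula Sig n 1 Γ
    ⋁ {zero}  φ = falsum
    ⋁ {suc k} φ = φ zero or ⋁ (φ ∘ suc)

    module _ (w : Word Sig) where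

      ⊭falsum : ∀ {Γ} (s : Assignment w Γ) → ¬ (_⊨_ w s falsum)
      ⊭falsum s (_ , lift x<x) = LinearOrder.irrefl (dom w) refl x<x

      ⊨⋁⁺ : ∀ {k Γ} (s : Assignment w Γ) (φ : Fin k → Formula Sig n 1 Γ) i → _⊨_ w s (φ i) → _⊨_ w s (⋁ φ)
      ⊨⋁⁺ s φ zero    h = inj₁ h
      ⊨⋁⁺ s φ (suc i) h = inj₂ (⊨⋁⁺ s (φ ∘ suc) i h)

      ⊨⋁⁻ : ∀ {k Γ} (s : Assignment w Γ) (φ : Fin k → Formula Sig n 1 Γ) → _⊨_ w s (⋁ φ) → ∃[ i ] _⊨_ w s (φ i)
      ⊨⋁⁻ {zero}  s φ h        = ⊥-elim (⊭falsum s h)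
      ⊨⋁⁻ {suc k} s φ (inj₁ h) = zero , h
      ⊨⋁⁻ {suc k} s φ (inj₂ h) = let i , h′ = ⊨⋁⁻ s (φ ∘ suc) h in suc i , h′

    unassigned : (w : Word Sig) → Assignment w {1} ∅
    unassigned w _ x∈∅ = ⊥-elim (∉⊥ x∈∅)

    atomIf : ∀ {A : Set} → Dec A → Sig → Formula Sig n 1 (⁅ zero ⁆ ∪ ∅)
    atomIf (yes _) a = atom a zero Vec.here
    atomIf (no _)  a = falsum

    letterIn : (Sig → Set) → Formula Sig n 1 (⁅ zero ⁆ ∪ ∅)
    letterIn P = ⋁ λ i → atomIf (dec (P (enum.from i))) (enum.from i)

    module _ (w : Word Sig) (s : Assignment w {1} ∅) (P : Sig → Set) (x : ∣ dom w ∣) where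

      ⊨letterIn⁺ : P (letter w x) → _⊨_ w (_[_≔_] w s zero x) (letterIn P)
      ⊨letterIn⁺ p = ⊨⋁⁺ w (_[_≔_] w s zero x) (λ i → atomIf (dec (P (enum.from i))) (enum.from i))
        (enum.to (letter w x)) (holds (sym (enum.strictlyInverseʳ _)) (dec _))
        where
        holds : ∀ {a} → letter w x ≡ a → (d : Dec (P a)) → _⊨_ w (_[_≔_] w s zero x) (atomIf d a)
        holds eq   (yes _) = lift eq
        holds refl (no ¬p) = contradiction p ¬p

      ⊨letterIn⁻ : _⊨_ w (_[_≔_] w s zero x) (letterIn P) → P (letter w x)
      ⊨letterIn⁻ h =
        let i , h′ = ⊨⋁⁻ w (_[_≔_] w s zero x) (λ i → atomIf (dec (P (enum.from i))) (enum.from i)) h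
        in holds (dec _) h′
        where
        holds : ∀ {a} (d : Dec (P a)) → _⊨_ w (_[_≔_] w s zero x) (atomIf d a) → P (letter w x)
        holds (yes p) (lift eq) = subst P (sym eq) p
        holds (no _)  h         = ⊥-elim (⊭falsum w (_[_≔_] w s zero x) h)

    -- The disjunct for `u` describes `u` limits over letters that supply the other `v ∸ u` levels;
    -- `u ≤ v ≤ n` keeps the quantifier available.
    atLeast : (Sig → Value) → Fin (suc n) → Sentence Sig n 1
    atLeast f v = ⋁ {suc (toℕ v)} λ u → ex∞ (Fin.inject≤ u (Fin.toℕ<n v)) zero (letterIn λ a → f a ⊒ toℕ v ℕ.∸ toℕ u)

    module _ (f : Sig → Value) (v : Fin (suc n)) (w : Word Sig) where

      private
        large : Fin (suc (toℕ v)) → Sig → Set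
        large u a = f a ⊒ toℕ v ℕ.∸ toℕ u
        part : Fin (suc (toℕ v)) → Sentence Sig n 1
        part u = ex∞ (Fin.inject≤ u (Fin.toℕ<n v)) zero (letterIn (large u))

      atLeast⁺ : DeepW (toℕ v) (map f w) everything → Satisfies w (atLeast f v)
      atLeast⁺ deep =
        let u , u≤v , deep-u = grade {α = dom w} deep
            X , X⊆ , rank = Deep⇒HasRank (dom w) deep-u
            u≡ = Fin.toℕ-fromℕ< u≤v
        in ⊨⋁⁺ w _ part (fromℕ< u≤v) (X ,
             subst (HasRank _) (sym (trans (Fin.toℕ-inject≤ (fromℕ< u≤v) (Fin.toℕ<n v)) u≡)) rank ,
             λ x x∈ → ⊨letterIn⁺ w _ (large (fromℕ< u≤v)) x
               (subst (λ t → f (letter w x) ⊒ toℕ v ℕ.∸ t) (sym u≡) (∈⁻ (proj₁ (∈⁻ (X⊆ x∈))))))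

      atLeast⁻ : Satisfies w (atLeast f v) → DeepW (toℕ v) (map f w) everything
      atLeast⁻ h =
        let u , X , rank , sat = ⊨⋁⁻ w _ part h
        in Deep-⊆ _ (ungrade {α = dom w} (ℕ.≤-pred (Fin.toℕ<n u)) (λ {x} x∈ → ⊨letterIn⁻ w _ (large u) x (sat x x∈))
             (HasRank⇒Deep (dom w) (countable w) (subst (HasRank _) (Fin.toℕ-inject≤ u (Fin.toℕ<n v)) rank)))

    -- From recognition to definability

    Agree : ∀ {k} → (Fin k → Sentence Sig n 1) → Word Sig → Word Sig → Set₁
    Agree Φ w v = ∀ i → Satisfies w (Φ i) ⇔ Satisfies v (Φ i)

    -- The arbitrary class `K` is split by the truth of one sentence at a time. When none is left,
    -- it only matters whether any word remains.
    separate : ∀ {k} (Φ : Fin k → Sentence Sig n 1) (K : Word Sig → Set₁) →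
               Σ[ φ ∈ Sentence Sig n 1 ] ∀ w → Satisfies w φ ⇔ (∃[ v ] K v × Agree Φ w v)
    separate {zero} Φ K with em₁ (∃ K)
    ... | yes (v , kv) = not falsum , λ w → mk⇔ (λ _ → v , kv , λ ()) (λ _ → ⊭falsum w (unassigned w))
    ... | no none      = falsum , λ w → mk⇔ (⊥-elim ∘ ⊭falsum w (unassigned w)) (λ (v , kv , _) → contradiction (v , kv) none)
    separate {suc k} Φ K = (Φ zero and φ⁺) or (not (Φ zero) and φ⁻) , λ w → mk⇔ (only-if w) (if w)
      where
      positive = separate (Φ ∘ suc) (λ v → K v × Satisfies v (Φ zero))
      negative = separate (Φ ∘ suc) (λ v → K v × ¬ Satisfies v (Φ zero))
      φ⁺ φ⁻ : Sentence Sig n 1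
      φ⁺ = proj₁ positive
      φ⁻ = proj₁ negative
      module Pos w = Equivalence (proj₂ positive w)
      module Neg w = Equivalence (proj₂ negative w)
      extend : ∀ {w v} → Satisfies w (Φ zero) ⇔ Satisfies v (Φ zero) → Agree (Φ ∘ suc) w v → Agree Φ w v
      extend e _ zero    = e
      extend _ a (suc i) = a i
      only-if : ∀ w → Satisfies w ((Φ zero and φ⁺) or (not (Φ zero) and φ⁻)) → ∃[ v ] K v × Agree Φ w v
      only-if w (inj₁ (h , h⁺)) = let v , (kv , hv) , a = Pos.to w h⁺ in
        v , kv , extend {w} {v} (mk⇔ (const hv) (const h)) a
      only-if w (inj₂ (h , h⁻)) = let v , (kv , hv) , a = Neg.to w h⁻ in
        v , kv , extend {w} {v} (mk⇔ (⊥-elim ∘ h) (⊥-elim ∘ hv)) a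
      if : ∀ w → ∃[ v ] K v × Agree Φ w v → Satisfies w ((Φ zero and φ⁺) or (not (Φ zero) and φ⁻))
      if w (v , kv , a) with em₁ (Satisfies w (Φ zero))
      ... | yes h = inj₁ (h , Pos.from w (v , (kv , Equivalence.to (a zero) h) , a ∘ suc))
      ... | no ¬h = inj₂ (¬h , Neg.from w (v , (kv , ¬h ∘ Equivalence.from (a zero)) , a ∘ suc))

    recognized⇒definable : (L : Language Sig) → RecognizedByΔ-product n L → Definable n 1 L
    recognized⇒definable L (D , induces , k , h , recognizes) = φ , λ w → mk⇔
      (λ w∈ → Equivalence.from (φ-spec w) (w , w∈ , λ _ → mk⇔ id id))
      (λ sat → let v , v∈ , a = Equivalence.to (φ-spec w) sat
               in Equivalence.from (recognizes w)
                    (v , v∈ , λ i → ⊒-ext (transfer {w} {v} a i) (transfer {v} {w} (⇔-sym ∘ a) i)))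
      where
      open Language L
      open Uniqueness n D induces using (π-⊒⁺; π-⊒⁻)
      open Morphism h
      open ⊛Monoid D using (π)

      f : Fin k → Sig → Value
      f i a = ⟦ singleton a ⟧ i

      -- Every word is the concatenation of its one-letter words, so the morphism is determined by
      -- its values on letters.
      ⟦⟧-letters : ∀ w i → ⟦ w ⟧ i ≡ π (map (f i) w)
      ⟦⟧-letters w i = trans (⟦⟧-cong {w} {concat (map singleton w)} (record
        { iso     = mk≃ (dom w) (dom (concat (map singleton w))) (_, zero) inter (λ { (x , zero) → x , refl })
        ; letters = λ _ → refl }) i) (homo (map singleton w) i)

      -- One sentence for each pair of a coordinate and a threshold; agreement on all of them forces
      -- equal images.
      Φ : Fin (k ℕ.* suc n) → Sentence Sig n 1
      Φ p = let i , v = Fin.remQuot {k} (suc n) p in atLeast (f i) v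

      separated = separate Φ _∈ᴸ
      φ = proj₁ separated
      φ-spec = proj₂ separated

      transfer : ∀ {w v} → Agree Φ w v → ∀ i {u} → ⟦ w ⟧ i ⊒ u → ⟦ v ⟧ i ⊒ u
      transfer {w} {v} a i {u} ⊒u =
        subst (_⊒ u) (sym (⟦⟧-letters v i)) (π-⊒⁺ (map (f i) v) u≤n
          (subst (λ t → DeepW t (map (f i) v) everything) u′≡ (atLeast⁻ (f i) u′ v
            (Equivalence.to agree (atLeast⁺ (f i) u′ w
              (subst (λ t → DeepW t (map (f i) w) everything) (sym u′≡)
                (π-⊒⁻ (map (f i) w) (subst (_⊒ u) (⟦⟧-letters w i) ⊒u))))))))
        where
        u≤n = ⊒-bound {⟦ w ⟧ i} ⊒u
        u′ = fromℕ< (s≤s u≤n)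
        u′≡ = Fin.toℕ-fromℕ< (s≤s u≤n)
        agree : Satisfies w (atLeast (f i) u′) ⇔ Satisfies v (atLeast (f i) u′)
        agree = subst (λ (i , u) → Satisfies w (atLeast (f i) u) ⇔ Satisfies v (atLeast (f i) u))
                  (Fin.remQuot-combine i u′) (a (Fin.combine i u′))

    -- From definability to recognition

    bits : Fin (2 ℕ.^ m) → Sig → Bool
    bits p a = Inverse.to Fin.2↔Bool (Fin.finToFun p (enum.to a))

    bits-surjective : ∀ B → ∃[ p ] ∀ a → bits p a ≡ B a
    bits-surjective B = Fin.funToFin digits , λ a → trans
      (cong (Inverse.to Fin.2↔Bool) (Fin.finToFun-funToFin digits (enum.to a)))
      (trans (Inverse.strictlyInverseˡ Fin.2↔Bool _) (cong B (enum.strictlyInverseʳ a)))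
      where
      digits : Fin m → Fin 2
      digits i = Inverse.from Fin.2↔Bool (B (enum.from i))

    -- One coordinate for each subset of the alphabet: its letters get level 0 and the others are
    -- erased, so the value measures the rank available on these positions.
    mark : Fin (2 ℕ.^ m) → Sig → Value
    mark p a = if bits p a then just zero else nothing

    profile : Word Sig → Fin (2 ℕ.^ m) → Value
    profile w p = eval (map (mark p) w)

    profileMorphism : Morphism (Free Sig) (power evalMonoid (2 ℕ.^ m))
    profileMorphism = record
      { ⟦_⟧     = profile
      ; ⟦⟧-cong = λ {v} {w} e p → ⊛Monoid.π-cong evalMonoid {map (mark p) v} {map (mark p) w}
                    (record { iso = _≅_.iso e ; letters = λ x → cong (mark p) (_≅_.letters e x) })
      ; homo    = λ W p → ⊛Monoid.π-concat evalMonoid (map (map (mark p)) W)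
      }

    marked : ∀ B w {j} → Deep (dom w) rank₀ j (B ∘ letter w) →
             DeepW j (map (mark (proj₁ (bits-surjective B))) w) everything
    marked B w = Deep-map id id _ λ { {x = x} x∈ refl → subst (λ b → (if b then just zero else nothing) ⊒ 0)
      (sym (proj₂ (bits-surjective B) (letter w x))) (on x∈) }
      where
      on : ∀ {b} → T b → (if b then just zero else nothing) ⊒ 0
      on {true} _ = z≤n

    unmarked : ∀ B w {j} → DeepW j (map (mark (proj₁ (bits-surjective B))) w) everything →
               Deep (dom w) rank₀ j (B ∘ letter w)
    unmarked B w = Deep-bind (λ x → ⟪ (λ y → y ≡ x × x ∈ B ∘ letter w) ⟫)
      (λ x<y a b → subst₂ (LinearOrder._<_ (dom w)) (sym (proj₁ (∈⁻ a))) (sym (proj₁ (∈⁻ b))) x<y)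
      (λ {u} {x} _ l → let x∈ , u≡0 = off (subst (λ b → (if b then just zero else nothing) ⊒ u)
                                              (proj₂ (bits-surjective B) (letter w x)) l)
                       in point x (∈⁺ (refl , x∈)) u≡0)
      (λ _ y∈ → let y≡x , x∈ = ∈⁻ y∈ in subst (_∈ B ∘ letter w) (sym y≡x) x∈)
      where
      off : ∀ {b u} → (if b then just zero else nothing) ⊒ u → T b × u ≡ 0
      off {true} z≤n = tt , refl

    _∼_ : Word Sig → Word Sig → Set
    w ∼ w′ = ∀ p → profile w p ≡ profile w′ p

    Deep-∼ : ∀ {w w′} → w ∼ w′ → ∀ B {j} → j ≤ n → Deep (dom w) rank₀ j (B ∘ letter w) →
             Deep (dom w′) rank₀ j (B ∘ letter w′)
    Deep-∼ {w} {w′} w∼w′ B j≤n deep = let p = proj₁ (bits-surjective B) in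
      unmarked B w′ (eval-⊒⁻ (map (mark p) w′) (subst (_⊒ _) (w∼w′ p) (eval-⊒⁺ (map (mark p) w) j≤n (marked B w deep))))

    occurs-∼ : ∀ {w w′} → w ∼ w′ → ∀ x → ∃[ x′ ] letter w x ≡ letter w′ x′
    occurs-∼ {w} {w′} w∼w′ x =
      let x′ , x′∈ = Deep-nonempty (Deep-∼ {w} {w′} w∼w′ (only (letter w x)) z≤n (point x (∈⁺ refl) refl))
      in x′ , sym (∈⁻ x′∈)

    -- With one variable, `less` compares a position with itself and is false. The current position
    -- matters only through its letter, and the rest of the word only through its profile.
    ⊨-∼ : ∀ {Γ} (φ : Formula Sig n 1 Γ) {w w′} → w ∼ w′ → (s : Assignment w Γ) (s′ : Assignment w′ Γ) →
          (∀ x x∈ → letter w (s x x∈) ≡ letter w′ (s′ x x∈)) → _⊨_ w s φ → _⊨_ w′ s′ φ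
    ⊨-∼ (less zero zero Vec.here Vec.here) {w} _ s _ _ (lift x<x) = ⊥-elim (LinearOrder.irrefl (dom w) refl x<x)
    ⊨-∼ (atom a x x∈) _ s s′ same (lift eq) = lift (trans (sym (same x x∈)) eq)
    ⊨-∼ (not φ) {w} {w′} w∼w′ s s′ same ¬φ = ¬φ ∘ ⊨-∼ φ {w′} {w} (sym ∘ w∼w′) s′ s (λ x x∈ → sym (same x x∈))
    ⊨-∼ (φ and ψ) {w} {w′} w∼w′ s s′ same (h , k) = ⊨-∼ φ {w} {w′} w∼w′ s s′ same h , ⊨-∼ ψ {w} {w′} w∼w′ s s′ same k
    ⊨-∼ (φ or ψ) {w} {w′} w∼w′ s s′ same (inj₁ h) = inj₁ (⊨-∼ φ {w} {w′} w∼w′ s s′ same h)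
    ⊨-∼ (φ or ψ) {w} {w′} w∼w′ s s′ same (inj₂ h) = inj₂ (⊨-∼ ψ {w} {w′} w∼w′ s s′ same h)
    ⊨-∼ (ex zero φ) {w} {w′} w∼w′ s s′ same (x , h) =
      let x′ , eq = occurs-∼ {w} {w′} w∼w′ x
      in x′ , ⊨-∼ φ {w} {w′} w∼w′ (_[_≔_] w s zero x) (_[_≔_] w′ s′ zero x′) (λ { zero _ → eq }) h
    ⊨-∼ (ex∞ j zero φ) {w} {w′} w∼w′ s s′ same (X , rank , sat) =
      let deep = Deep-∼ {w} {w′} w∼w′ B (ℕ.≤-pred (Fin.toℕ<n j))
                   (Deep-⊆ (λ {x} x∈ → fromWitness {a? = em₁ (Good (letter w x))} (x , refl , sat x x∈))
                     (HasRank⇒Deep (dom w) (countable w) rank))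
          X′ , X′⊆ , rank′ = Deep⇒HasRank (dom w′) deep
      in X′ , rank′ , λ x′ x′∈ →
           let x , eq , h = toWitness {a? = em₁ (Good (letter w′ x′))} (X′⊆ x′∈)
           in ⊨-∼ φ {w} {w′} w∼w′ (_[_≔_] w s zero x) (_[_≔_] w′ s′ zero x′) (λ { zero _ → eq }) h
      where
      -- Satisfaction of `φ` depends on the letter alone, so the quantified set may be enlarged to
      -- all positions with a good letter; depth of such a set is visible in the profile.
      Good : Sig → Set₁
      Good a = ∃[ x ] letter w x ≡ a × _⊨_ w (_[_≔_] w s zero x) φ
      B : Sig → Bool
      B a = ⌊ em₁ (Good a) ⌋

    definable⇒recognized : (L : Language Sig) → Definable n 1 L → RecognizedByΔ-product n L
    definable⇒recognized L (φ , defines) = evalMonoid , evalMonoid-induces , 2 ℕ.^ m , profileMorphism ,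
      λ w → mk⇔ (λ w∈ → w , w∈ , λ _ → refl)
                (λ (v , v∈ , w∼v) → Equivalence.from (defines w)
                  (⊨-∼ φ {v} {w} (sym ∘ w∼v) _ _ (λ x x∈ → ⊥-elim (∉⊥ x∈)) (Equivalence.to (defines v) v∈)))

theorem4 : (∀ {ℓ} → ExcludedMiddle ℓ) →
    ∀ (n : ℕ) {Sig : Set} {m : ℕ} → Sig ↔ Fin m → (L : Language Sig) →
    RecognizedByΔ-product n L ⇔ Definable n 1 L
theorem4 em n enum L = mk⇔ (recognized⇒definable L) (definable⇒recognized L)
  where open Classical.Logic em n enum
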